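{- Let $d$ be a fixed positive integer. Every $n$-vertex graph $G$ with VC-dimension at most $d$ contains a clique or an independent set of size at least $e^{(\log n)^{1-o(1)}}$, where the $o(1)$ term tends to $0$ as $n\to\infty$ and may depend on $d$.
   Context: All graphs are finite and simple. For a graph $G=(V,E)$ and $v\in V$, $N(v)$ denotes the set of vertices adjacent to $v$ (so $v\notin N(v)$). The VC-dimension of a set system $\mathcal{F}$ on a ground set $V$ is the largest integer $d$ for which there is a $d$-element set $S\subset V$ such that for every $B\subset S$ there is $A\in\mathcal{F}$ with $A\cap S=B$. The VC-dimension of a graph $G$ is the VC-dimension of the set system $\{N(v): v\in V\}$ on ground set $V$. Logarithms are natural. -}

module Defs where

open import Data.Nat using (ℕ; suc; _≤_; _^_; _∸_)
open import Data.Nat.Logarithm using (⌊log₂_⌋)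
open import Data.Bool using (Bool; true; false)
open import Data.Fin using (Fin)
open import Data.Fin.Subset using (Subset; _∈_; _⊆_; ∣_∣)
open import Data.Product using (Σ; ∃; _×_)
open import Relation.Binary.PropositionalEquality using (_≡_; _≢_)
open import Relation.Nullary using (¬_)

record Graph (n : ℕ) : Set where
  field
    adj   : Fin n → Fin n → Bool
    sym   : ∀ u v → adj u v ≡ adj v u
    irrefl : ∀ v → adj v v ≡ false
open Graph public

InNbhd : ∀ {n} → Graph n → Fin n → Fin n → Set
InNbhd G v u = adj G v u ≡ true

Shattered : ∀ {n} → Graph n → Subset n → Set
Shattered {n} G S =
  (B : Subset n) → B ⊆ S →
  ∃ λ (v : Fin n) → ∀ (u : Fin n) → u ∈ S →
    (u ∈ B → InNbhd G v u) × (InNbhd G v u → u ∈ B)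

VCdim≤ : ∀ {n} → Graph n → ℕ → Set
VCdim≤ {n} G d = (S : Subset n) → Shattered G S → ∣ S ∣ ≤ d

IsClique : ∀ {n} → Graph n → Subset n → Set
IsClique G S = ∀ u v → u ∈ S → v ∈ S → u ≢ v → adj G u v ≡ true

IsIndependent : ∀ {n} → Graph n → Subset n → Set
IsIndependent G S = ∀ u v → u ∈ S → v ∈ S → adj G u v ≡ false

{-# OPTIONS --safe #-}
module Submission where

-- If twins are vertices with almost equal neighbourhoods, a greedy choice of O(D log n) points
-- makes any two vertices with the same trace on them twins up to n / D vertices, and by the
-- Sauer–Shelah lemma few traces occur.  Hence one can choose x₁, …, xₜ and large sets W₁, …, Wₜ of
-- twins of x₁, …, xₜ one after the other so that every Wⱼ is almost homogeneous to every vertex of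
-- Wᵢ (j < i), in the way the pair xⱼ xᵢ prescribes.  Choosing cographs with z vertices inside the
-- Wᵢ, from the last to the first, and substituting them into a cograph with s vertices of the
-- graph induced on the xᵢ yields a cograph with s z vertices.  If P (s , x) says that every graph
-- on 2ˣ vertices contains a cograph on 2ˢ vertices, this reads (with t = z = 2ᵃ)
--   P (s , a) and P (a , x) imply P (s + a , x + C a)   as long as  x + C a ≤ 2²ᵃ,
-- and iterating it turns P (rᵏ , c rᵏ⁺¹) for all large r into P (rᵏ⁺¹ , c′ rᵏ⁺²) for all large r.
-- A cograph on m² vertices contains a clique or an independent set of size m.

open import Defs
open import Algebra.Properties.CommutativeSemigroup using (interchange; x∙yz≈y∙xz)
open import Data.Bool using (Bool; true; false; _∧_; _∨_)
import Data.Bool as Bool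
open import Data.Bool.Properties using (¬-not)
open import Data.Fin as Fin using (Fin; zero; suc)
open import Data.Fin.Subset using (Subset; ∣_∣)
open import Data.Fin.Subset as Subset using (⁅_⁆; _∪_)
open import Data.Fin.Subset.Properties
  using (x∈⁅x⁆; x∈⁅y⁆⇒x≡y; x∈p∪q⁻; x∈p∪q⁺; q⊆p∪q; p⊂q⇒∣p∣<∣q∣; ∉⊥)
open import Data.List as List
  using (List; []; _∷_; _++_; length; filter; take; allFin; cartesianProduct)
open import Data.List.Membership.Propositional using (_∈_; lose)
open import Data.List.Membership.Propositional.Properties
  using (∈-++⁺ˡ; ∈-++⁺ʳ; ∈-++⁻; ∈-filter⁺; ∈-filter⁻; ∈-cartesianProduct⁺)
open import Data.List.Properties
  using (length-++; length-map; length-filter; length-take; length-tabulate)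
open import Data.List.Relation.Binary.Sublist.Propositional
  using (_⊆_; []; _∷_; _∷ʳ_; ⊆-refl; ⊆-trans)
import Data.List.Relation.Binary.Sublist.Propositional as Sublist
open import Data.List.Relation.Binary.Sublist.Propositional.Properties
  using (filter-⊆; take-⊆; All-resp-⊆)
open import Data.List.Relation.Unary.All as All using ([]; _∷_)
open import Data.List.Relation.Unary.AllPairs using ([]; _∷_)
open import Data.List.Relation.Unary.Any using (Any; here; there; any?)
open import Data.List.Relation.Unary.Unique.Propositional using (Unique)
import Data.List.Relation.Unary.Unique.Propositional.Properties as Unique
open import Data.Nat hiding (_≟_)
open import Data.Nat.Induction using (<-rec)
open import Data.Nat.ListAction using (sum)
open import Data.Nat.Logarithm using (⌊log₂_⌋; ⌊log₂⌋-mono-≤; ⌊log₂⌊n/2⌋⌋≡⌊log₂n⌋∸1; ⌊log₂[2^n]⌋≡n)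
open import Data.Nat.Properties hiding (_≟_)
open import Data.Nat.Tactic.RingSolver using (solve-∀)
open import Data.Product using (Σ; ∃; _×_; _,_; proj₁; proj₂)
open import Data.Sum using (_⊎_; inj₁; inj₂; [_,_]′)
open import Data.Unit using (⊤; tt)
open import Data.Vec as Vec using (Vec; []; _∷_; lookup)
open import Data.Vec.Properties
  using (map-∘; map-cong; lookup-map; lookup-replicate; []=⇒lookup; lookup⇒[]=; length-toList;
         ≡-dec; ∷-injectiveˡ; ∷-injectiveʳ)
open import Function using (_∘_)
open import Relation.Binary.PropositionalEquality
  using (_≡_; _≢_; refl; trans; cong; cong₂; subst; module ≡-Reasoning)
  renaming (sym to ≡-sym)
open import Relation.Nullary using (¬_; Dec; yes; no; contradiction; ¬?; _⊎-dec_)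
open import Relation.Nullary.Decidable using (decidable-stable)

-- The Sauer–Shelah lemma

bit : Bool → ℕ
bit true  = 1
bit false = 0

positive : ℕ → Bool
positive zero    = false
positive (suc _) = true

∑cube : ∀ {m} → (Vec Bool m → ℕ) → ℕ
∑cube {zero}  g = g []
∑cube {suc m} g = ∑cube (g ∘ (true ∷_)) + ∑cube (g ∘ (false ∷_))

card : ∀ {m} → (Vec Bool m → Bool) → ℕ
card F = ∑cube (bit ∘ F)

∑cube-cong : ∀ {m} {f g : Vec Bool m → ℕ} → (∀ p → f p ≡ g p) → ∑cube f ≡ ∑cube g
∑cube-cong {zero}  h = h []
∑cube-cong {suc m} h = cong₂ _+_ (∑cube-cong (h ∘ (true ∷_))) (∑cube-cong (h ∘ (false ∷_)))

∑cube-+ : ∀ {m} (f g : Vec Bool m → ℕ) → ∑cube (λ p → f p + g p) ≡ ∑cube f + ∑cube g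
∑cube-+ {zero}  f g = refl
∑cube-+ {suc m} f g
  rewrite ∑cube-+ (f ∘ (true ∷_)) (g ∘ (true ∷_))
        | ∑cube-+ (f ∘ (false ∷_)) (g ∘ (false ∷_)) =
  interchange +-commutativeSemigroup (∑cube (f ∘ (true ∷_))) (∑cube (g ∘ (true ∷_)))
    (∑cube (f ∘ (false ∷_))) (∑cube (g ∘ (false ∷_)))

∑cube-zero : ∀ {m} → ∑cube {m} (λ _ → 0) ≡ 0
∑cube-zero {zero}  = refl
∑cube-zero {suc m} = cong₂ _+_ (∑cube-zero {m}) (∑cube-zero {m})

-- Pigeonhole over the support of `g`. In the induction it suffices to keep the heavier of the two
-- points found in the halves of the cube.
∑cube-heaviest : ∀ {m} (g : Vec Bool m → ℕ) →
                 ∃ λ p → ∑cube g ≤ card (positive ∘ g) * g p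
∑cube-heaviest {zero} g = [] , lem (g [])
  where
  lem : ∀ a → a ≤ bit (positive a) * a
  lem zero    = z≤n
  lem (suc a) = m≤m+n (suc a) 0
∑cube-heaviest {suc m} g
  with ∑cube-heaviest (g ∘ (true ∷_)) | ∑cube-heaviest (g ∘ (false ∷_))
... | p₁ , h₁ | p₀ , h₀ with ≤-total (g (true ∷ p₁)) (g (false ∷ p₀))
... | inj₁ le = (false ∷ p₀) , (begin
  _ ≤⟨ +-mono-≤ h₁ h₀ ⟩
  c₁ * g (true ∷ p₁) + c₀ * g (false ∷ p₀) ≤⟨ +-monoˡ-≤ _ (*-monoʳ-≤ c₁ le) ⟩
  c₁ * g (false ∷ p₀) + c₀ * g (false ∷ p₀) ≡⟨ *-distribʳ-+ (g (false ∷ p₀)) c₁ c₀ ⟨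
  (c₁ + c₀) * g (false ∷ p₀) ∎)
  where
  open ≤-Reasoning
  c₁ = card (positive ∘ g ∘ (true ∷_))
  c₀ = card (positive ∘ g ∘ (false ∷_))
... | inj₂ le = (true ∷ p₁) , (begin
  _ ≤⟨ +-mono-≤ h₁ h₀ ⟩
  c₁ * g (true ∷ p₁) + c₀ * g (false ∷ p₀) ≤⟨ +-monoʳ-≤ (c₁ * g (true ∷ p₁)) (*-monoʳ-≤ c₀ le) ⟩
  c₁ * g (true ∷ p₁) + c₀ * g (true ∷ p₁) ≡⟨ *-distribʳ-+ (g (true ∷ p₁)) c₁ c₀ ⟨
  (c₁ + c₀) * g (true ∷ p₁) ∎)
  where
  open ≤-Reasoning
  c₁ = card (positive ∘ g ∘ (true ∷_))
  c₀ = card (positive ∘ g ∘ (false ∷_))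

-- Number of subsets of an m-set with fewer than e elements.
sauerBound : ℕ → ℕ → ℕ
sauerBound m       zero    = 0
sauerBound zero    (suc e) = 1
sauerBound (suc m) (suc e) = sauerBound m (suc e) + sauerBound m e

sauerBound-≤ : ∀ m d → sauerBound m (suc d) ≤ suc m ^ d
sauerBound-≤ zero    d       = m^n>0 1 d
sauerBound-≤ (suc m) zero    rewrite +-identityʳ (sauerBound m 1) = sauerBound-≤ m 0
sauerBound-≤ (suc m) (suc d) = begin
  sauerBound m (suc (suc d)) + sauerBound m (suc d)
    ≤⟨ +-mono-≤ (sauerBound-≤ m (suc d)) (sauerBound-≤ m d) ⟩
  suc m * suc m ^ d + suc m ^ d  ≡⟨ +-comm (suc m * suc m ^ d) _ ⟩
  suc (suc m) * suc m ^ d        ≤⟨ *-monoʳ-≤ (suc (suc m)) (^-monoˡ-≤ d (n≤1+n (suc m))) ⟩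
  suc (suc m) * suc (suc m) ^ d  ∎
  where open ≤-Reasoning

-- For the two halves of a family on a cube, union and intersection share its size between them. If
-- that size exceeds the Pascal sum in `sauerBound`, one of them exceeds its summand.
card-∨-∧ : ∀ {m} (F G : Vec Bool m → Bool) →
           card (λ p → F p ∨ G p) + card (λ p → F p ∧ G p) ≡ card F + card G
card-∨-∧ F G = begin
  card (λ p → F p ∨ G p) + card (λ p → F p ∧ G p)
    ≡⟨ ∑cube-+ (λ p → bit (F p ∨ G p)) (λ p → bit (F p ∧ G p)) ⟨
  ∑cube (λ p → bit (F p ∨ G p) + bit (F p ∧ G p))
    ≡⟨ ∑cube-cong (λ p → bit-∨-∧ (F p) (G p)) ⟩
  ∑cube (λ p → bit (F p) + bit (G p))
    ≡⟨ ∑cube-+ (bit ∘ F) (bit ∘ G) ⟩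
  card F + card G ∎
  where
  open ≡-Reasoning
  bit-∨-∧ : ∀ a b → bit (a ∨ b) + bit (a ∧ b) ≡ bit a + bit b
  bit-∨-∧ true  true  = refl
  bit-∨-∧ true  false = refl
  bit-∨-∧ false true  = refl
  bit-∨-∧ false false = refl

card-nonempty : ∀ {m} (F : Vec Bool m → Bool) → 0 < card F → ∃ λ p → F p ≡ true
card-nonempty {zero} F 0<c with F [] in eq
... | true  = [] , eq
... | false = contradiction 0<c λ ()
card-nonempty {suc m} F 0<c with card (F ∘ (true ∷_)) in eq
... | zero  with p , h ← card-nonempty (F ∘ (false ∷_)) 0<c = false ∷ p , h
... | suc c with p , h ← card-nonempty (F ∘ (true ∷_)) (subst (0 <_) (≡-sym eq) z<s) = true ∷ p , h

+-<-split : ∀ a b {c d} → a + b < c + d → a < c ⊎ b < d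
+-<-split a b {c} {d} lt with a <? c
... | yes a<c = inj₁ a<c
... | no  a≮c with b <? d
... | yes b<d = inj₂ b<d
... | no  b≮d = contradiction lt (≤⇒≯ (+-mono-≤ (≮⇒≥ a≮c) (≮⇒≥ b≮d)))

-- A repeated coordinate carries equal bits in every point, so shattering by itself makes the
-- coordinates distinct.
ShattersCoords : ∀ {m e} → (Vec Bool m → Bool) → Vec (Fin m) e → Set
ShattersCoords {e = e} F is =
  (bs : Vec Bool e) → ∃ λ p → F p ≡ true × Vec.map (lookup p) is ≡ bs

∨-true : ∀ a b → a ∨ b ≡ true → a ≡ true ⊎ b ≡ true
∨-true true  b h = inj₁ refl
∨-true false b h = inj₂ h

∧-true : ∀ a b → a ∧ b ≡ true → a ≡ true × b ≡ true
∧-true true b h = refl , h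

-- Split F by its first coordinate into F₁ and F₀: a set shattered by F₁ ∨ F₀
-- is shattered by F, and one shattered by F₁ ∧ F₀ can be enlarged by that coordinate.
sauer : ∀ m e (F : Vec Bool m → Bool) → sauerBound m e < card F →
        Σ (Vec (Fin m) e) (ShattersCoords F)
sauer m zero F lt with p , h ← card-nonempty F lt = [] , λ { [] → p , h , refl }
sauer zero (suc e) F lt with F []
... | true  = contradiction lt λ { (s≤s ()) }
... | false = contradiction lt λ ()
sauer (suc m) (suc e) F lt
  with +-<-split (sauerBound m (suc e)) (sauerBound m e)
         (subst (sauerBound (suc m) (suc e) <_)
                (≡-sym (card-∨-∧ (F ∘ (true ∷_)) (F ∘ (false ∷_)))) lt)
... | inj₁ lt∨ with is , sh ← sauer m (suc e) _ lt∨ = Vec.map suc is , sh′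
  where
  sh′ : ShattersCoords F (Vec.map suc is)
  sh′ bs with p , h , eq ← sh bs with ∨-true (F (true ∷ p)) (F (false ∷ p)) h
  ... | inj₁ h₁ = true ∷ p , h₁ , trans (≡-sym (map-∘ (lookup (true ∷ p)) suc is)) eq
  ... | inj₂ h₀ = false ∷ p , h₀ , trans (≡-sym (map-∘ (lookup (false ∷ p)) suc is)) eq
... | inj₂ lt∧ with is , sh ← sauer m e _ lt∧ = zero ∷ Vec.map suc is , sh′
  where
  sh′ : ShattersCoords F (zero ∷ Vec.map suc is)
  sh′ (b ∷ bs) with p , h , eq ← sh bs =
    b ∷ p , both b , cong (b ∷_) (trans (≡-sym (map-∘ (lookup (b ∷ p)) suc is)) eq)
    where
    both : ∀ b → F (b ∷ p) ≡ true
    both true  = proj₁ (∧-true (F (true ∷ p)) (F (false ∷ p)) h)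
    both false = proj₂ (∧-true (F (true ∷ p)) (F (false ∷ p)) h)

-- Traces and their fibres

infix 4 _≟ᵖ_

_≟ᵖ_ : ∀ {m} (p q : Vec Bool m) → Dec (p ≡ q)
_≟ᵖ_ = ≡-dec Bool._≟_

𝟙 : ∀ {P : Set} → Dec P → ℕ
𝟙 (yes _) = 1
𝟙 (no _)  = 0

𝟙-cong : ∀ {P Q : Set} (P? : Dec P) (Q? : Dec Q) → (P → Q) → (Q → P) → 𝟙 P? ≡ 𝟙 Q?
𝟙-cong (yes _) (yes _) _ _ = refl
𝟙-cong (yes p) (no ¬q) f _ = contradiction (f p) ¬q
𝟙-cong (no ¬p) (yes q) _ g = contradiction (g q) ¬p
𝟙-cong (no _)  (no _)  _ _ = refl

𝟙-no : ∀ {P : Set} (P? : Dec P) → ¬ P → 𝟙 P? ≡ 0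
𝟙-no (yes p) ¬p = contradiction p ¬p
𝟙-no (no _)  _  = refl

module _ {A : Set} where

  -- VC-dimension below `e` over an arbitrary vertex type. Vectors in place of sets let the
  -- condition pull back along any map, injective or not.
  NoShatter : (A → A → Bool) → ℕ → Set
  NoShatter adj e = (ys : Vec A e) → ¬ ((bs : Vec Bool e) → ∃ λ v → Vec.map (adj v) ys ≡ bs)

  ∑ : List A → (A → ℕ) → ℕ
  ∑ xs f = sum (List.map f xs)

  module _ {m} (tr : A → Vec Bool m) where

    fibre : List A → Vec Bool m → List A
    fibre U p = filter (λ u → tr u ≟ᵖ p) U

    ∑cube-fibres : ∀ U → ∑cube (length ∘ fibre U) ≡ length U
    ∑cube-fibres []      = ∑cube-zero {m}
    ∑cube-fibres (u ∷ U) = begin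
      ∑cube (length ∘ fibre (u ∷ U))
        ≡⟨ ∑cube-cong step ⟩
      ∑cube (λ p → 𝟙 (tr u ≟ᵖ p) + length (fibre U p))
        ≡⟨ ∑cube-+ (λ p → 𝟙 (tr u ≟ᵖ p)) (length ∘ fibre U) ⟩
      ∑cube (λ p → 𝟙 (tr u ≟ᵖ p)) + ∑cube (length ∘ fibre U)
        ≡⟨ cong₂ _+_ (∑cube-point (tr u)) (∑cube-fibres U) ⟩
      suc (length U) ∎
      where
      open ≡-Reasoning
      step : ∀ p → length (fibre (u ∷ U) p) ≡ 𝟙 (tr u ≟ᵖ p) + length (fibre U p)
      step p with tr u ≟ᵖ p
      ... | yes _ = refl
      ... | no _  = refl
      ∑cube-point : ∀ {k} (q : Vec Bool k) → ∑cube (λ p → 𝟙 (q ≟ᵖ p)) ≡ 1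
      ∑cube-point []      = refl
      ∑cube-point {suc k} (b ∷ q) = trans (cong₂ _+_ (half true (b Bool.≟ true)) (half false (b Bool.≟ false))) (one b)
        where
        half : ∀ c (b≟c : Dec (b ≡ c)) → ∑cube (λ p → 𝟙 (b ∷ q ≟ᵖ c ∷ p)) ≡ 𝟙 b≟c
        half c (yes refl) = trans
          (∑cube-cong λ p → 𝟙-cong (b ∷ q ≟ᵖ b ∷ p) (q ≟ᵖ p) ∷-injectiveʳ (cong (b ∷_)))
          (∑cube-point q)
        half c (no b≢c) = trans
          (∑cube-cong λ p → 𝟙-no (b ∷ q ≟ᵖ c ∷ p) (b≢c ∘ ∷-injectiveˡ))
          (∑cube-zero {k})
        one : ∀ b → 𝟙 (b Bool.≟ true) + 𝟙 (b Bool.≟ false) ≡ 1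
        one true  = refl
        one false = refl

  -- Coordinates shattered by the traces that occur in `U` would give `e` entries of `xs` shattered
  -- by `adj`. So at most `sauerBound m e` traces occur, and the heaviest fibre has at least average
  -- size.
  popular-trace : ∀ {adj : A → A → Bool} {e m} → NoShatter adj e → (xs : Vec A m) (U : List A) →
                  ∃ λ p → length U ≤ sauerBound m e * length (fibre (λ u → Vec.map (adj u) xs) U p)
  popular-trace {adj} {e} {m} nosh xs U with ∑cube-heaviest (length ∘ fibre (λ u → Vec.map (adj u) xs) U)
  ... | p , h = p , (begin
    length U                       ≡⟨ ∑cube-fibres tr U ⟨
    ∑cube (length ∘ fibre tr U)    ≤⟨ h ⟩
    card F * length (fibre tr U p) ≤⟨ *-monoˡ-≤ _ (≮⇒≥ (λ lt → ¬shattered (sauer m e F lt))) ⟩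
    sauerBound m e * length (fibre tr U p) ∎)
    where
    open ≤-Reasoning
    tr : A → Vec Bool m
    tr u = Vec.map (adj u) xs
    F : Vec Bool m → Bool
    F = positive ∘ length ∘ fibre tr U
    realised : ∀ q → F q ≡ true → ∃ λ u → tr u ≡ q
    realised q h with fibre tr U q in eq
    realised q () | []
    ... | u ∷ _ = u , proj₂ (∈-filter⁻ (λ u → tr u ≟ᵖ q) {xs = U} (subst (u ∈_) (≡-sym eq) (here refl)))
    ¬shattered : ¬ Σ (Vec (Fin m) e) (ShattersCoords F)
    ¬shattered (is , sh) = nosh (Vec.map (lookup xs) is) λ bs → case-of (sh bs)
      where
      case-of : ∀ {bs} → (∃ λ p → F p ≡ true × Vec.map (lookup p) is ≡ bs) →
                ∃ λ v → Vec.map (adj v) (Vec.map (lookup xs) is) ≡ bs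
      case-of (q , Fq , refl) with u , refl ← realised q Fq = u , (trans
        (≡-sym (map-∘ (adj u) (lookup xs) is))
        (map-cong (λ i → ≡-sym (lookup-map i (adj u) xs)) is))

-- Cotrees

data Tree (A : Set) : Set where
  leaf : A → Tree A
  node : Bool → Tree A → Tree A → Tree A

size : ∀ {A} → Tree A → ℕ
size (leaf _)     = 1
size (node _ l r) = size l + size r

infix 4 _∈ᵗ_

data _∈ᵗ_ {A : Set} (x : A) : Tree A → Set where
  here  : x ∈ᵗ leaf x
  left  : ∀ {b l r} → x ∈ᵗ l → x ∈ᵗ node b l r
  right : ∀ {b l r} → x ∈ᵗ r → x ∈ᵗ node b l r

Symmetric : ∀ {A : Set} → (A → A → Bool) → Set
Symmetric adj = ∀ u v → adj u v ≡ adj v u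

Joined : ∀ {A : Set} → (A → A → Bool) → Bool → Tree A → Tree A → Set
Joined adj b l r = ∀ {u v} → u ∈ᵗ l → v ∈ᵗ r → u ≢ v × adj u v ≡ b

-- The leaves of τ are distinct and induce the cograph with cotree τ:
-- nodes labelled true are joins, nodes labelled false are disjoint unions.
Cotree : ∀ {A : Set} → (A → A → Bool) → Tree A → Set
Cotree adj (leaf _)     = ⊤
Cotree adj (node b l r) = Cotree adj l × Cotree adj r × Joined adj b l r

size>0 : ∀ {A} (τ : Tree A) → 0 < size τ
size>0 (leaf _)     = z<s
size>0 (node _ l r) = ≤-trans (size>0 l) (m≤m+n (size l) (size r))

leaves : ∀ {A} → Tree A → List A
leaves (leaf x)     = x ∷ []
leaves (node _ l r) = leaves l ++ leaves r

length-leaves : ∀ {A} (τ : Tree A) → length (leaves τ) ≡ size τ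
length-leaves (leaf _)     = refl
length-leaves (node _ l r) =
  trans (length-++ (leaves l)) (cong₂ _+_ (length-leaves l) (length-leaves r))

∈-leaves : ∀ {A} {x : A} {τ} → x ∈ᵗ τ → x ∈ leaves τ
∈-leaves here      = here refl
∈-leaves (left i)  = ∈-++⁺ˡ (∈-leaves i)
∈-leaves {τ = node _ l _} (right i) = ∈-++⁺ʳ (leaves l) (∈-leaves i)

-- Cographs are hereditary: the right subtree is cut first, the left one only when the right is
-- gone. Exact sizes make the size of a substitution a plain product.
prune : ∀ {A : Set} {adj : A → A → Bool} s τ → 0 < s → s ≤ size τ → Cotree adj τ →
        ∃ λ σ → size σ ≡ s × Cotree adj σ × (∀ {x} → x ∈ᵗ σ → x ∈ᵗ τ)
prune s (leaf x) 0<s s≤1 _ = leaf x , ≤-antisym 0<s s≤1 , tt , λ i → i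
prune s (node b l r) 0<s s≤ (cl , cr , j) with s ≤? size l
... | yes s≤l with σ , eq , cσ , sub ← prune s l 0<s s≤l cl = σ , eq , cσ , left ∘ sub
... | no  s≰l
  with σ , eq , cσ , sub ← prune (s ∸ size l) r (m<n⇒0<n∸m (≰⇒> s≰l)) (m≤n+o⇒m∸n≤o s (size l) s≤) cr =
  node b l σ , trans (cong (size l +_) eq) (m+[n∸m]≡n (<⇒≤ (≰⇒> s≰l))) ,
  (cl , cσ , λ i i′ → j i (sub i′)) , λ { (left i) → left i ; (right i) → right (sub i) }

graft : ∀ {I A : Set} → (I → Tree A) → Tree I → Tree A
graft f (leaf i)     = f i
graft f (node b l r) = node b (graft f l) (graft f r)

size-graft : ∀ {I A : Set} (f : I → Tree A) z → (∀ i → size (f i) ≡ z) →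
             ∀ τ → size (graft f τ) ≡ size τ * z
size-graft f z h (leaf i)     = trans (h i) (≡-sym (+-identityʳ z))
size-graft f z h (node b l r) =
  trans (cong₂ _+_ (size-graft f z h l) (size-graft f z h r)) (≡-sym (*-distribʳ-+ z (size l) (size r)))

∈-graft⁻ : ∀ {I A : Set} (f : I → Tree A) τ {x} → x ∈ᵗ graft f τ → ∃ λ i → i ∈ᵗ τ × x ∈ᵗ f i
∈-graft⁻ f (leaf i)     p         = i , here , p
∈-graft⁻ f (node b l r) (left p)  with i , q , p′ ← ∈-graft⁻ f l p = i , left q , p′
∈-graft⁻ f (node b l r) (right p) with i , q , p′ ← ∈-graft⁻ f r p = i , right q , p′

-- Leaves of different trees `f i` and `f j` meet at the node where `i` and `j` meet, and its label
-- is `adjᴵ i j`.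
Cotree-graft : ∀ {I A : Set} {adjᴵ : I → I → Bool} {adj : A → A → Bool} (f : I → Tree A) →
               (∀ i → Cotree adj (f i)) →
               (∀ i j → i ≢ j → Joined adj (adjᴵ i j) (f i) (f j)) →
               ∀ τ → Cotree adjᴵ τ → Cotree adj (graft f τ)
Cotree-graft f cf jf (leaf i)     _             = cf i
Cotree-graft f cf jf (node b l r) (cl , cr , j) =
  Cotree-graft f cf jf l cl , Cotree-graft f cf jf r cr , joined
  where
  joined : Joined _ b (graft f l) (graft f r)
  joined u∈ v∈ with ∈-graft⁻ f l u∈ | ∈-graft⁻ f r v∈
  ... | i , i∈l , u∈f | i′ , i′∈r , v∈f with i≢i′ , refl ← j i∈l i′∈r = jf i i′ i≢i′ u∈f v∈f

-- Cliques and independent sets in cographs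

Homogeneous : ∀ {A : Set} → (A → A → Bool) → Bool → List A → Set
Homogeneous adj b xs = Unique xs × (∀ {u v} → u ∈ xs → v ∈ xs → u ≢ v → adj u v ≡ b)

module _ {A : Set} {adj : A → A → Bool} (sym-adj : Symmetric adj) where

  HomogeneousIn : Bool → Tree A → Set
  HomogeneousIn b τ = ∃ λ xs → Homogeneous adj b xs × (∀ {x} → x ∈ xs → x ∈ᵗ τ)

  hlen : ∀ {b τ} → HomogeneousIn b τ → ℕ
  hlen (xs , _) = length xs

  private
    -- The `b`-homogeneous lists are concatenated, while of the `c`-homogeneous ones the longer is
    -- kept: `x y + x′ y′ ≤ (x + x′) max (y , y′)`.
    combine : ∀ {b c c′ l r} → Joined adj b l r →
              (X : HomogeneousIn b l) (X′ : HomogeneousIn b r) →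
              (Y : HomogeneousIn c l) (Y′ : HomogeneousIn c r) →
              Σ (HomogeneousIn b (node c′ l r)) λ Z → Σ (HomogeneousIn c (node c′ l r)) λ W →
              hlen X * hlen Y + hlen X′ * hlen Y′ ≤ hlen Z * hlen W
    combine {b} {c} {c′} {l} {r} j (xs , (xu , xh) , xs∈) (xs′ , (xu′ , xh′) , xs′∈)
            (ys , hy , ys∈) (ys′ , hy′ , ys′∈) with ≤-total (length ys) (length ys′)
    ... | le = Z , W le , (begin
      length xs * length ys + length xs′ * length ys′
        ≤⟨ +-mono-≤ (*-monoʳ-≤ (length xs) (proj₁ (maxW le))) (*-monoʳ-≤ (length xs′) (proj₂ (maxW le))) ⟩
      length xs * hlen (W le) + length xs′ * hlen (W le)
        ≡⟨ *-distribʳ-+ (hlen (W le)) (length xs) (length xs′) ⟨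
      (length xs + length xs′) * hlen (W le)
        ≡⟨ cong (_* hlen (W le)) (length-++ xs) ⟨
      length (xs ++ xs′) * hlen (W le) ∎)
      where
      open ≤-Reasoning
      N = node c′ l r
      zh : ∀ {u v} → u ∈ xs ++ xs′ → v ∈ xs ++ xs′ → u ≢ v → adj u v ≡ b
      zh u∈ v∈ u≢v with ∈-++⁻ xs u∈ | ∈-++⁻ xs v∈
      ... | inj₁ p | inj₁ q = xh p q u≢v
      ... | inj₂ p | inj₂ q = xh′ p q u≢v
      ... | inj₁ p | inj₂ q = proj₂ (j (xs∈ p) (xs′∈ q))
      ... | inj₂ p | inj₁ q = trans (sym-adj _ _) (proj₂ (j (xs∈ q) (xs′∈ p)))
      z∈ : ∀ {x} → x ∈ xs ++ xs′ → x ∈ᵗ N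
      z∈ p with ∈-++⁻ xs p
      ... | inj₁ q = left (xs∈ q)
      ... | inj₂ q = right (xs′∈ q)
      Z : HomogeneousIn b N
      Z = xs ++ xs′ , (Unique.++⁺ xu xu′ (λ (p , q) → proj₁ (j (xs∈ p) (xs′∈ q)) refl) , zh) , z∈
      W : length ys ≤ length ys′ ⊎ length ys′ ≤ length ys → HomogeneousIn c N
      W (inj₁ _) = ys′ , hy′ , right ∘ ys′∈
      W (inj₂ _) = ys , hy , left ∘ ys∈
      maxW : ∀ le → length ys ≤ hlen (W le) × length ys′ ≤ hlen (W le)
      maxW (inj₁ h) = h , ≤-refl
      maxW (inj₂ h) = ≤-refl , h

  -- The inequality `n ≤ ω α` of perfect graphs. At a join cliques add up, at a disjoint union
  -- independent sets do, so the last case exchanges the two roles.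
  cograph-ramsey : ∀ τ → Cotree adj τ →
                   Σ (HomogeneousIn true τ) λ X → Σ (HomogeneousIn false τ) λ Y →
                   size τ ≤ hlen X * hlen Y
  cograph-ramsey (leaf x) _ = single , single , s≤s z≤n
    where
    single : ∀ {b} → HomogeneousIn b (leaf x)
    single = x ∷ [] , ([] ∷ [] , λ { (here refl) (here refl) x≢x → contradiction refl x≢x }) ,
             λ { (here refl) → here }
  cograph-ramsey (node true l r) (cl , cr , j)
    with X , Y , h ← cograph-ramsey l cl | X′ , Y′ , h′ ← cograph-ramsey r cr
    with Z , W , k ← combine {c′ = true} j X X′ Y Y′ = Z , W , ≤-trans (+-mono-≤ h h′) k
  cograph-ramsey (node false l r) (cl , cr , j)
    with X , Y , h ← cograph-ramsey l cl | X′ , Y′ , h′ ← cograph-ramsey r cr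
    with Z , W , k ← combine {c′ = false} j Y Y′ X X′ = W , Z , (begin
      size l + size r                     ≤⟨ +-mono-≤ h h′ ⟩
      hlen X * hlen Y + hlen X′ * hlen Y′ ≡⟨ cong₂ _+_ (*-comm (hlen X) _) (*-comm (hlen X′) _) ⟩
      hlen Y * hlen X + hlen Y′ * hlen X′ ≤⟨ k ⟩
      hlen Z * hlen W                     ≡⟨ *-comm (hlen Z) _ ⟩
      hlen W * hlen Z                     ∎)
    where open ≤-Reasoning

leaves-∈ : ∀ {A} {x : A} τ → x ∈ leaves τ → x ∈ᵗ τ
leaves-∈ (leaf _)     (here refl) = here
leaves-∈ (node _ l r) i with ∈-++⁻ (leaves l) i
... | inj₁ p = left (leaves-∈ l p)
... | inj₂ p = right (leaves-∈ r p)

-- Double counting and separating sets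

module _ {A : Set} where

  ∑-mono : ∀ xs {f g : A → ℕ} → (∀ {x} → x ∈ xs → f x ≤ g x) → ∑ xs f ≤ ∑ xs g
  ∑-mono []       h = z≤n
  ∑-mono (x ∷ xs) h = +-mono-≤ (h (here refl)) (∑-mono xs (h ∘ there))

  ∑-+ : ∀ xs (f g : A → ℕ) → ∑ xs (λ x → f x + g x) ≡ ∑ xs f + ∑ xs g
  ∑-+ []       f g = refl
  ∑-+ (x ∷ xs) f g rewrite ∑-+ xs f g = interchange +-commutativeSemigroup (f x) (g x) (∑ xs f) (∑ xs g)

  ∑-*ˡ : ∀ xs c (f : A → ℕ) → ∑ xs (λ x → c * f x) ≡ c * ∑ xs f
  ∑-*ˡ []       c f = ≡-sym (*-zeroʳ c)
  ∑-*ˡ (x ∷ xs) c f rewrite ∑-*ˡ xs c f = ≡-sym (*-distribˡ-+ c (f x) (∑ xs f))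

  ∑-const : ∀ (xs : List A) c → ∑ xs (λ _ → c) ≡ length xs * c
  ∑-const []       c = refl
  ∑-const (x ∷ xs) c = cong (c +_) (∑-const xs c)

  ∑-⊆ : ∀ {xs ys} (f : A → ℕ) → xs ⊆ ys → ∑ xs f ≤ ∑ ys f
  ∑-⊆ f []         = z≤n
  ∑-⊆ f (y ∷ʳ s)   = ≤-trans (∑-⊆ f s) (m≤n+m _ (f y))
  ∑-⊆ f (refl ∷ s) = +-monoʳ-≤ _ (∑-⊆ f s)

  module _ {P : A → Set} (P? : ∀ x → Dec (P x)) where

    length-filter-∑ : ∀ xs → length (filter P? xs) ≡ ∑ xs (λ x → 𝟙 (P? x))
    length-filter-∑ []       = refl
    length-filter-∑ (x ∷ xs) with P? x
    ... | yes _ = cong suc (length-filter-∑ xs)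
    ... | no _  = length-filter-∑ xs

    length-filter-¬ : ∀ xs → length (filter P? xs) + length (filter (¬? ∘ P?) xs) ≡ length xs
    length-filter-¬ []       = refl
    length-filter-¬ (x ∷ xs) with P? x
    ... | yes _ = cong suc (length-filter-¬ xs)
    ... | no _  = trans (+-suc _ _) (cong suc (length-filter-¬ xs))

  ∑-average : ∀ xs c (f : A → ℕ) → 0 < length xs → length xs * c ≤ ∑ xs f → ∃ λ x → x ∈ xs × c ≤ f x
  ∑-average (x ∷ xs) c f _ h with c ≤? f x
  ... | yes c≤ = x , here refl , c≤
  ∑-average (x ∷ []) c f _ h | no c≰ = contradiction (+-cancelʳ-≤ 0 c (f x) h) c≰
  ∑-average (x ∷ xs@(_ ∷ _)) c f _ h | no c≰
    with y , y∈ , c≤ ← ∑-average xs c f z<s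
           (+-cancelˡ-≤ (f x) _ _ (≤-trans (+-monoˡ-≤ _ (<⇒≤ (≰⇒> c≰))) h)) = y , there y∈ , c≤

∑-swap : ∀ {A B : Set} (xs : List A) (ys : List B) (f : A → B → ℕ) →
         ∑ xs (λ x → ∑ ys (f x)) ≡ ∑ ys (λ y → ∑ xs (λ x → f x y))
∑-swap []       ys f = ≡-sym (trans (∑-const ys 0) (*-zeroʳ (length ys)))
∑-swap (x ∷ xs) ys f rewrite ∑-swap xs ys f = ≡-sym (∑-+ ys (f x) (λ y → ∑ xs (λ x → f x y)))

length-cartesianProduct : ∀ {A B : Set} (xs : List A) (ys : List B) →
                          length (cartesianProduct xs ys) ≡ length xs * length ys
length-cartesianProduct []       ys = refl
length-cartesianProduct (x ∷ xs) ys = trans (length-++ (List.map (x ,_) ys))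
  (cong₂ _+_ (length-map (x ,_) ys) (length-cartesianProduct xs ys))

-- Bernoulli's inequality for (1 + 1/E)ʲ, cleared of denominators.
bernoulli : ∀ E j → E ^ j * (E + j) ≤ E * suc E ^ j
bernoulli E zero    = ≤-reflexive (rearr E)
  where
  rearr : ∀ E → 1 * (E + 0) ≡ E * 1
  rearr = solve-∀
bernoulli E (suc j) = begin
  E * E ^ j * (E + suc j)           ≤⟨ m≤m+n _ (E ^ j * j) ⟩
  E * E ^ j * (E + suc j) + E ^ j * j ≡⟨ rearr E (E ^ j) j ⟩
  suc E * (E ^ j * (E + j))         ≤⟨ *-monoʳ-≤ (suc E) (bernoulli E j) ⟩
  suc E * (E * suc E ^ j)           ≡⟨ x∙yz≈y∙xz *-commutativeSemigroup (suc E) E (suc E ^ j) ⟩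
  E * (suc E * suc E ^ j)           ∎
  where
  open ≤-Reasoning
  rearr : ∀ E p j → E * p * (E + suc j) + p * j ≡ suc E * (p * (E + j))
  rearr = solve-∀

2*E^E≤ : ∀ E → 0 < E → 2 * E ^ E ≤ suc E ^ E
2*E^E≤ E@(suc _) _ = *-cancelˡ-≤ E (begin
  E * (2 * E ^ E) ≡⟨ rearr E (E ^ E) ⟩
  E ^ E * (E + E) ≤⟨ bernoulli E E ⟩
  E * suc E ^ E   ∎)
  where
  open ≤-Reasoning
  rearr : ∀ a b → a * (2 * b) ≡ b * (a + a)
  rearr = solve-∀

^-*ˡ : ∀ a b n → (a * b) ^ n ≡ a ^ n * b ^ n
^-*ˡ a b zero    = refl
^-*ˡ a b (suc n) rewrite ^-*ˡ a b n = rearr a b (a ^ n) (b ^ n)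
  where
  rearr : ∀ a b c d → a * b * (c * d) ≡ a * c * (b * d)
  rearr = solve-∀

-- If a greedy round keeps the fraction `E / (1 + E)` of the pairs, then `E` rounds at least halve
-- them, and `E * q` rounds exhaust any number of pairs below `2 ^ q`.
2^q*E^≤ : ∀ E q → 0 < E → 2 ^ q * E ^ (E * q) ≤ suc E ^ (E * q)
2^q*E^≤ E q 0<E = begin
  2 ^ q * E ^ (E * q)   ≡⟨ cong (2 ^ q *_) (^-*-assoc E E q) ⟨
  2 ^ q * (E ^ E) ^ q   ≡⟨ ^-*ˡ 2 (E ^ E) q ⟨
  (2 * E ^ E) ^ q       ≤⟨ ^-monoˡ-≤ q (2*E^E≤ E 0<E) ⟩
  (suc E ^ E) ^ q       ≡⟨ ^-*-assoc (suc E) E q ⟩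
  suc E ^ (E * q)       ∎
  where open ≤-Reasoning

module Separation {A : Set} (adj : A → A → Bool) where

  trace : ∀ {m} → Vec A m → A → Vec Bool m
  trace ys u = Vec.map (adj u) ys

  separates? : ∀ u v y → Dec (adj u y ≢ adj v y)
  separates? u v y = ¬? (adj u y Bool.≟ adj v y)

  dist : List A → A → A → ℕ
  dist U u v = length (filter (separates? u v) U)

  separatedBy : A → List (A × A) → List (A × A)
  separatedBy y = filter (λ (u , v) → separates? u v y)

  -- Double counting: every pair in `L` has more than `length U / D` separators in `U`, so an
  -- average vertex of `U` separates at least the fraction `1 / D` of the pairs.
  good-separator : ∀ D U (L : List (A × A)) → 0 < length U →
                   (∀ {u v} → (u , v) ∈ L → length U < D * dist U u v) →
                   ∃ λ y → length L ≤ D * length (separatedBy y L)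
  good-separator D U L 0<U far =
    let y , _ , h = ∑-average U (length L) (λ y → D * length (separatedBy y L)) 0<U averaged in y , h
    where
    open ≤-Reasoning
    averaged : length U * length L ≤ ∑ U (λ y → D * length (separatedBy y L))
    averaged = begin
      length U * length L  ≡⟨ *-comm (length U) _ ⟩
      length L * length U  ≡⟨ ∑-const L (length U) ⟨
      ∑ L (λ _ → length U) ≤⟨ ∑-mono L (<⇒≤ ∘ far) ⟩
      ∑ L (λ (u , v) → D * dist U u v)
        ≡⟨ ∑-*ˡ L D _ ⟩
      D * ∑ L (λ (u , v) → dist U u v)
        ≤⟨ *-monoʳ-≤ D (∑-mono L λ {(u , v)} _ → ≤-reflexive (length-filter-∑ (separates? u v) U)) ⟩
      D * ∑ L (λ (u , v) → ∑ U (λ y → 𝟙 (separates? u v y)))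
        ≡⟨ cong (D *_) (∑-swap L U _) ⟩
      D * ∑ U (λ y → ∑ L (λ (u , v) → 𝟙 (separates? u v y)))
        ≤⟨ *-monoʳ-≤ D (∑-mono U λ {y} _ → ≤-reflexive (≡-sym (length-filter-∑ (λ (u , v) → separates? u v y) L))) ⟩
      D * ∑ U (λ y → length (separatedBy y L))
        ≡⟨ ∑-*ˡ U D _ ⟨
      ∑ U (λ y → D * length (separatedBy y L)) ∎

  -- Greedy: some point separates a fraction 1/(1+E) of the pairs not yet separated.
  separating-set : ∀ E U j (L : List (A × A)) → 0 < length U →
                   (∀ {u v} → (u , v) ∈ L → length U < suc E * dist U u v) →
                   E ^ j * length L < suc E ^ j →
                   Σ (Vec A j) λ Y → ∀ {u v} → (u , v) ∈ L → trace Y u ≢ trace Y v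
  separating-set E U zero    []      0<U far lt = [] , λ ()
  separating-set E U zero    (p ∷ L) 0<U far lt = contradiction lt λ { (s≤s ()) }
  separating-set E U (suc j) L       0<U far lt =
    let y , h   = good-separator (suc E) U L 0<U far
        Y , sep = separating-set E U j (filter (λ (u , v) → ¬? (separates? u v y)) L) 0<U
                    (far ∘ proj₁ ∘ ∈-filter⁻ (λ (u , v) → ¬? (separates? u v y)) {xs = L}) (shrink y h)
    in y ∷ Y , sep′ y Y sep
    where
    sep′ : ∀ y Y →
           (∀ {u v} → (u , v) ∈ filter (λ (u , v) → ¬? (separates? u v y)) L → trace Y u ≢ trace Y v) →
           ∀ {u v} → (u , v) ∈ L → trace (y ∷ Y) u ≢ trace (y ∷ Y) v
    sep′ y Y sep {u} {v} uv∈ eq = sep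
      (∈-filter⁺ (λ (u , v) → ¬? (separates? u v y)) uv∈ (λ ne → ne (∷-injectiveˡ eq)))
      (∷-injectiveʳ eq)
    shrink : ∀ y → length L ≤ suc E * length (separatedBy y L) →
             E ^ j * length (filter (λ (u , v) → ¬? (separates? u v y)) L) < suc E ^ j
    shrink y h = *-cancelˡ-< (suc E) _ _ (begin-strict
      suc E * (E ^ j * r)       ≡⟨ x∙yz≈y∙xz *-commutativeSemigroup (suc E) (E ^ j) r ⟩
      E ^ j * (suc E * r)       ≤⟨ *-monoʳ-≤ (E ^ j) step ⟩
      E ^ j * (E * length L)    ≡⟨ rearr (E ^ j) E (length L) ⟩
      E * E ^ j * length L      <⟨ lt ⟩
      suc E * suc E ^ j         ∎)
      where
      open ≤-Reasoning
      rearr : ∀ a b c → a * (b * c) ≡ b * a * c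
      rearr = solve-∀
      s = length (separatedBy y L)
      r = length (filter (λ (u , v) → ¬? (separates? u v y)) L)
      step : suc E * r ≤ E * length L
      step = +-cancelˡ-≤ (suc E * s) _ _ (begin
        suc E * s + suc E * r      ≡⟨ *-distribˡ-+ (suc E) s r ⟨
        suc E * (s + r)            ≡⟨ cong (suc E *_) (length-filter-¬ (λ (u , v) → separates? u v y) L) ⟩
        length L + E * length L    ≤⟨ +-monoˡ-≤ _ h ⟩
        suc E * s + E * length L   ∎)

  -- `separating-set` is applied to the pairs at distance above `length U / (1 + E)`, fewer than
  -- `2 ^ q` in number. Equal traces on `Y` therefore mean near-twins.
  net : ∀ E q U → 0 < E → 0 < length U → length U * length U < 2 ^ q →
        Σ (Vec A (E * q)) λ Y → ∀ {u v} → u ∈ U → v ∈ U →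
        trace Y u ≡ trace Y v → suc E * dist U u v ≤ length U
  net E q U 0<E 0<U small = Y , λ {u} {v} u∈ v∈ eq →
      ≮⇒≥ (λ far → sep (∈-filter⁺ far? (∈-cartesianProduct⁺ u∈ v∈) far) eq)
    where
    open ≤-Reasoning
    far? : ∀ (p : A × A) → Dec (length U < suc E * dist U (proj₁ p) (proj₂ p))
    far? (u , v) = length U <? suc E * dist U u v
    L = filter far? (cartesianProduct U U)
    few : E ^ (E * q) * length L < suc E ^ (E * q)
    few = begin-strict
      E ^ (E * q) * length L ≤⟨ *-monoʳ-≤ (E ^ (E * q)) (≤-trans (length-filter far? (cartesianProduct U U))
                                  (≤-reflexive (length-cartesianProduct U U))) ⟩
      E ^ (E * q) * (length U * length U)
                             <⟨ *-monoʳ-< (E ^ (E * q)) {{m^n≢0 E (E * q) {{>-nonZero 0<E}}}} small ⟩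
      E ^ (E * q) * 2 ^ q    ≡⟨ *-comm _ (2 ^ q) ⟩
      2 ^ q * E ^ (E * q)    ≤⟨ 2^q*E^≤ E q 0<E ⟩
      suc E ^ (E * q)        ∎
    result = separating-set E U (E * q) L 0<U (proj₂ ∘ ∈-filter⁻ far? {xs = cartesianProduct U U}) few
    Y = proj₁ result
    sep : ∀ {u v} → (u , v) ∈ L → trace Y u ≢ trace Y v
    sep = proj₂ result

-- Families of twin classes

CotreeIn : ∀ {N} → (Fin N → Fin N → Bool) → ℕ → List (Fin N) → Set
CotreeIn adj s U = ∃ λ τ → size τ ≡ s × Cotree adj τ × (∀ {u} → u ∈ᵗ τ → u ∈ U)

-- Ranging over lists inside any `Fin N` and over symmetric relations makes this apply both to a
-- twin class and to the relation pulled back to indices, where different indices may stand for one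
-- vertex.
HasCographs : (e s n : ℕ) → Set
HasCographs e s n = ∀ {N} (adj : Fin N → Fin N → Bool) → Symmetric adj → NoShatter adj e →
                    (U : List (Fin N)) → Unique U → n ≤ length U → CotreeIn adj s U

NoShatter-pullback : ∀ {A B : Set} {adj : A → A → Bool} {e} (f : B → A) →
                     NoShatter adj e → NoShatter (λ i j → adj (f i) (f j)) e
NoShatter-pullback {adj = adj} f nosh ys sh = nosh (Vec.map f ys) λ bs →
  let i , eq = sh bs in f i , trans (≡-sym (map-∘ (adj (f i)) f ys)) eq

nonempty : ∀ {A : Set} (xs : List A) → 0 < length xs → ∃ (_∈ xs)
nonempty (x ∷ _) _ = x , here refl

unique-⊆ : ∀ {A : Set} {xs ys : List A} → xs ⊆ ys → Unique ys → Unique xs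
unique-⊆ []         []         = []
unique-⊆ (y ∷ʳ s)   (_ ∷ uys)  = unique-⊆ s uys
unique-⊆ (refl ∷ s) (y∉ ∷ uys) = All-resp-⊆ s y∉ ∷ unique-⊆ s uys

module _ {N} {u : Fin N} where

  occurs-at-most-once : ∀ {xs} → Unique xs → ∑ xs (λ v → 𝟙 (u Fin.≟ v)) ≤ 1
  occurs-at-most-once []                  = z≤n
  occurs-at-most-once {x ∷ xs} (x∉ ∷ uxs) with u Fin.≟ x
  ... | no _     = occurs-at-most-once uxs
  ... | yes refl = s≤s (≤-trans (∑-mono xs λ {v} v∈ → ≤-reflexive (𝟙-no (u Fin.≟ v) (All.lookup x∉ v∈)))
                               (≤-reflexive (trans (∑-const xs 0) (*-zeroʳ (length xs)))))

-- There are `t` classes, each to receive a cograph of size `z`, which any `w` vertices contain.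
-- With `E = 2tz`, up to `t z` vertices with at most `length W / E` mismatches each spoil at most
-- half of a class `W`. With `D = 4tE`, at most `n / 2t` vertices have more mismatches than that.
-- `M` bounds the length of the trace vectors, and `room` makes popular classes large.
module Blocks {N} (adj : Fin N → Fin N → Bool) (sym-adj : Symmetric adj)
              {e} (nosh : NoShatter adj e) (U : List (Fin N)) (uU : Unique U)
              {t z w D : ℕ} (0<t : 0 < t) (0<z : 0 < z) (0<w : 0 < w)
              (D≡ : D ≡ 4 * t * (2 * t * z)) (D≤ : D ≤ length U)
              (small : HasCographs e z w)
              (M : ℕ) (room : ∀ {p} → p ≤ M → sauerBound p e * (4 * w) ≤ length U) where

  open Separation adj

  private
    n = length U
    E = 2 * t * z

  -- `P` consists of a net and of the vertices `x` chosen so far: the net makes a trace class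
  -- consist of near-twins, the other entries fix the adjacency to earlier choices.
  Near : ∀ {p} → Vec (Fin N) p → Set
  Near P = ∀ {u v} → u ∈ U → v ∈ U → trace P u ≡ trace P v → D * dist U u v ≤ n

  -- The alternative u ≡ v makes trees chosen in different classes disjoint.
  mismatch? : ∀ x u v → Dec (adj u v ≢ adj x v ⊎ u ≡ v)
  mismatch? x u v = separates? u x v ⊎-dec (u Fin.≟ v)

  mismatches : Fin N → List (Fin N) → Fin N → ℕ
  mismatches x W v = length (filter (λ u → mismatch? x u v) W)

  good? : ∀ x W v → Dec (E * mismatches x W v ≤ length W)
  good? x W v = E * mismatches x W v ≤? length W

  -- The tree T k is a cograph inside a set of near-twins of x k, chosen so that
  -- all pairs between T j and T k agree with the pair x j, x k.
  record Family (i : ℕ) {p} (P : Vec (Fin N) p) (V : List (Fin N)) : Set where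
    field
      x         : Fin i → Fin N
      T         : Fin i → Tree (Fin N)
      size-T    : ∀ k → size (T k) ≡ z
      cotree-T  : ∀ k → Cotree adj (T k)
      trace-T   : ∀ k {v} → v ∈ᵗ T k → trace P v ≡ trace P (x k)
      joined-T  : ∀ j k → j ≢ k → Joined adj (adj (x j) (x k)) (T j) (T k)
      pool      : List (Fin N)
      pool-size : length pool ≡ i * z
      T⊆pool    : ∀ k {v} → v ∈ᵗ T k → v ∈ pool
      pool⊆V    : ∀ {v} → v ∈ pool → v ∈ V

  -- Count the mismatching pairs in `W` × `U`. Each `u` in `W` has at most `n / D` separators from
  -- `x`, plus `u` itself, hence at most `2n / D` mismatches because `D ≤ n`. Each bad `v` uses up
  -- more than `length W / E` of them.
  bad-bound : ∀ x W → W ⊆ U → 0 < length W → (∀ {u} → u ∈ W → D * dist U u x ≤ n) →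
              ∀ {V} → V ⊆ U → 2 * t * length (filter (¬? ∘ good? x W) V) ≤ n
  bad-bound x W W⊆U 0<W near {V} V⊆U = *-cancelˡ-≤ (2 * E) {{>-nonZero 0<2E}} (*-cancelʳ-≤ _ _ (length W) {{>-nonZero 0<W}} (begin
    2 * E * (2 * t * b) * length W          ≡⟨ rearr E t b (length W) ⟩
    4 * t * E * (b * length W)              ≡⟨ cong (_* (b * length W)) D≡ ⟨
    D * (b * length W)                      ≡⟨ cong (D *_) (∑-const B (length W)) ⟨
    D * ∑ B (λ _ → length W)                ≤⟨ *-monoʳ-≤ D (∑-mono B λ v∈ → <⇒≤ (≰⇒> (proj₂ (∈-filter⁻ (¬? ∘ good? x W) {xs = V} v∈)))) ⟩
    D * ∑ B (λ v → E * mismatches x W v)    ≤⟨ *-monoʳ-≤ D (∑-⊆ _ (⊆-trans (filter-⊆ (¬? ∘ good? x W) V) V⊆U)) ⟩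
    D * ∑ U (λ v → E * mismatches x W v)    ≡⟨ cong (D *_) (∑-*ˡ U E _) ⟩
    D * (E * ∑ U (mismatches x W))          ≤⟨ *-monoʳ-≤ D (*-monoʳ-≤ E (∑-mono U λ {v} _ → ≤-reflexive (length-filter-∑ (λ u → mismatch? x u v) W))) ⟩
    D * (E * ∑ U (λ v → ∑ W (λ u → 𝟙 (mismatch? x u v))))
                                            ≡⟨ cong (λ k → D * (E * k)) (∑-swap U W _) ⟩
    D * (E * ∑ W (λ u → ∑ U (λ v → 𝟙 (mismatch? x u v))))
                                            ≡⟨ x∙yz≈y∙xz *-commutativeSemigroup D E _ ⟩
    E * (D * ∑ W (λ u → ∑ U (λ v → 𝟙 (mismatch? x u v))))
                                            ≡⟨ cong (E *_) (∑-*ˡ W D _) ⟨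
    E * ∑ W (λ u → D * ∑ U (λ v → 𝟙 (mismatch? x u v)))
                                            ≤⟨ *-monoʳ-≤ E (∑-mono W row) ⟩
    E * ∑ W (λ _ → 2 * n)                   ≡⟨ cong (E *_) (∑-const W (2 * n)) ⟩
    E * (length W * (2 * n))                ≡⟨ rearr′ E (length W) n ⟩
    2 * E * n * length W                    ∎))
    where
    open ≤-Reasoning
    B = filter (¬? ∘ good? x W) V
    b = length B
    0<2E : 0 < 2 * E
    0<2E = *-mono-≤ {1} {2} (s≤s z≤n) (*-mono-≤ (*-mono-≤ {1} {2} (s≤s z≤n) 0<t) 0<z)
    rearr : ∀ E t b l → 2 * E * (2 * t * b) * l ≡ 4 * t * E * (b * l)
    rearr = solve-∀
    rearr′ : ∀ E l n → E * (l * (2 * n)) ≡ 2 * E * n * l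
    rearr′ = solve-∀
    𝟙-⊎ : ∀ {P Q : Set} (P? : Dec P) (Q? : Dec Q) → 𝟙 (P? ⊎-dec Q?) ≤ 𝟙 P? + 𝟙 Q?
    𝟙-⊎ (yes _) _       = s≤s z≤n
    𝟙-⊎ (no _)  (yes _) = s≤s z≤n
    𝟙-⊎ (no _)  (no _)  = z≤n
    row : ∀ {u} → u ∈ W → D * ∑ U (λ v → 𝟙 (mismatch? x u v)) ≤ 2 * n
    row {u} u∈ = begin
      D * ∑ U (λ v → 𝟙 (mismatch? x u v))
        ≤⟨ *-monoʳ-≤ D (∑-mono U λ {v} _ → 𝟙-⊎ (separates? u x v) (u Fin.≟ v)) ⟩
      D * ∑ U (λ v → 𝟙 (separates? u x v) + 𝟙 (u Fin.≟ v))
        ≡⟨ cong (D *_) (∑-+ U _ _) ⟩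
      D * (∑ U (λ v → 𝟙 (separates? u x v)) + ∑ U (λ v → 𝟙 (u Fin.≟ v)))
        ≤⟨ *-monoʳ-≤ D (+-mono-≤ (≤-reflexive (≡-sym (length-filter-∑ (separates? u x) U))) (occurs-at-most-once uU)) ⟩
      D * (dist U u x + 1)       ≡⟨ *-distribˡ-+ D (dist U u x) 1 ⟩
      D * dist U u x + D * 1     ≤⟨ +-mono-≤ (near u∈) (≤-trans (≤-reflexive (*-identityʳ D)) D≤) ⟩
      n + n                      ≡⟨ cong (n +_) (+-identityʳ n) ⟨
      2 * n                      ∎

  clean? : ∀ x (R : List (Fin N)) u → Dec (¬ Any (λ v → adj u v ≢ adj x v ⊎ u ≡ v) R)
  clean? x R u = ¬? (any? (mismatch? x u) R)

  clean-agrees : ∀ x W R {u} → u ∈ filter (clean? x R) W →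
                 u ∈ W × (∀ {v} → v ∈ R → u ≢ v × adj u v ≡ adj x v)
  clean-agrees x W R {u} u∈ = proj₁ split , λ {v} v∈ →
      (λ u≡v → proj₂ split (lose v∈ (inj₂ u≡v))) ,
      decidable-stable (adj u v Bool.≟ adj x v) (λ ne → proj₂ split (lose v∈ (inj₁ ne)))
    where
    split : u ∈ W × ¬ Any (λ v → adj u v ≢ adj x v ⊎ u ≡ v) R
    split = ∈-filter⁻ (clean? x R) {xs = W} u∈

  -- Union bound: each of the at most `t z` vertices of `R` mismatches at most `length W / 2tz`
  -- vertices of `W`.
  clean-bound : ∀ x W R → length R ≤ t * z → (∀ {v} → v ∈ R → E * mismatches x W v ≤ length W) →
                length W ≤ 2 * length (filter (clean? x R) W)
  clean-bound x W R R≤ good = +-cancelˡ-≤ (2 * k) _ _ (begin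
    2 * k + length W                                    ≤⟨ +-monoˡ-≤ (length W) half ⟩
    length W + length W                                 ≡⟨ cong (length W +_) (+-identityʳ (length W)) ⟨
    2 * length W                                        ≡⟨ cong (2 *_) (length-filter-¬ dirty? W) ⟨
    2 * (k + length (filter (clean? x R) W))            ≡⟨ *-distribˡ-+ 2 k _ ⟩
    2 * k + 2 * length (filter (clean? x R) W)          ∎)
    where
    open ≤-Reasoning
    dirty? : ∀ u → Dec (Any (λ v → adj u v ≢ adj x v ⊎ u ≡ v) R)
    dirty? u = any? (mismatch? x u) R
    k = length (filter dirty? W)
    𝟙-any : ∀ u R → 𝟙 (any? (mismatch? x u) R) ≤ ∑ R (λ v → 𝟙 (mismatch? x u v))
    𝟙-any u []      = z≤n
    𝟙-any u (v ∷ R) with mismatch? x u v | any? (mismatch? x u) R | 𝟙-any u R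
    ... | yes _ | _     | _  = s≤s z≤n
    ... | no _  | yes _ | ih = ih
    ... | no _  | no _  | _  = z≤n
    0<tz : 0 < t * z
    0<tz = *-mono-≤ 0<t 0<z
    half : 2 * k ≤ length W
    half = *-cancelˡ-≤ (t * z) {{>-nonZero 0<tz}} (begin
      t * z * (2 * k)                                     ≡⟨ rearr t z k ⟩
      E * k                                               ≡⟨ cong (E *_) (length-filter-∑ dirty? W) ⟩
      E * ∑ W (λ u → 𝟙 (dirty? u))                        ≤⟨ *-monoʳ-≤ E (∑-mono W λ {u} _ → 𝟙-any u R) ⟩
      E * ∑ W (λ u → ∑ R (λ v → 𝟙 (mismatch? x u v)))     ≡⟨ cong (E *_) (∑-swap W R _) ⟩
      E * ∑ R (λ v → ∑ W (λ u → 𝟙 (mismatch? x u v)))     ≤⟨ *-monoʳ-≤ E (∑-mono R λ {v} _ → ≤-reflexive (≡-sym (length-filter-∑ (λ u → mismatch? x u v) W))) ⟩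
      E * ∑ R (mismatches x W)                            ≡⟨ ∑-*ˡ R E _ ⟨
      ∑ R (λ v → E * mismatches x W v)                    ≤⟨ ∑-mono R good ⟩
      ∑ R (λ _ → length W)                                ≡⟨ ∑-const R (length W) ⟩
      length R * length W                                 ≤⟨ *-monoˡ-≤ (length W) R≤ ⟩
      t * z * length W                                    ∎)
      where
      rearr : ∀ t z k → t * z * (2 * k) ≡ 2 * t * z * k
      rearr = solve-∀

  -- The later classes already have their trees when the tree of this class is chosen. It is found
  -- among the vertices of `W` that agree with `x₀` on all of `pool`; as `pool` has at most `t z`
  -- vertices, at least `w` candidates remain.
  module Extend {i p} {P : Vec (Fin N) p} {V V₁ : List (Fin N)} (i≤ : suc i ≤ t)
                (x₀ : Fin N) (W : List (Fin N)) (W⊆U : W ⊆ U) (W⊆V : ∀ {u} → u ∈ W → u ∈ V)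
                (same-trace : ∀ {u} → u ∈ W → trace P u ≡ trace P x₀) (2w≤W : 2 * w ≤ length W)
                (V₁⊆V : ∀ {v} → v ∈ V₁ → v ∈ V)
                (good : ∀ {v} → v ∈ V₁ → E * mismatches x₀ W v ≤ length W)
                (rest : Family i (x₀ ∷ P) V₁) where

    private
      module F = Family rest

    W₁ = filter (clean? x₀ F.pool) W
    w≤W₁ : w ≤ length W₁
    w≤W₁ = *-cancelˡ-≤ 2 (≤-trans 2w≤W (clean-bound x₀ W F.pool
      (≤-trans (≤-reflexive F.pool-size) (*-monoˡ-≤ z (<⇒≤ i≤))) (good ∘ F.pool⊆V)))

    abstract
      inner : CotreeIn adj z W₁
      inner = small adj sym-adj nosh W₁
        (unique-⊆ (⊆-trans (filter-⊆ (clean? x₀ F.pool) W) W⊆U) uU) w≤W₁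
    T₀ = proj₁ inner
    size-T₀ = proj₁ (proj₂ inner)
    cotree-T₀ = proj₁ (proj₂ (proj₂ inner))
    T₀⊆W₁ : ∀ {u} → u ∈ᵗ T₀ → u ∈ W₁
    T₀⊆W₁ = proj₂ (proj₂ (proj₂ inner))
    T₀⊆W : ∀ {u} → u ∈ᵗ T₀ → u ∈ W
    T₀⊆W u∈ = proj₁ (clean-agrees x₀ W F.pool (T₀⊆W₁ u∈))

    -- Replacing `u` by `x₀` is justified by the agreement on the pool, replacing `v` by `F.x k` by
    -- the fact that `x₀` is the first entry of the vector on which both have the same trace.
    joined₀ : ∀ k → Joined adj (adj x₀ (F.x k)) T₀ (F.T k)
    joined₀ k {u} {v} u∈ v∈ = proj₁ agree , trans (proj₂ agree)
      (trans (sym-adj x₀ v) (trans (∷-injectiveˡ (F.trace-T k v∈)) (sym-adj (F.x k) x₀)))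
      where
      agree : u ≢ v × adj u v ≡ adj x₀ v
      agree = proj₂ (clean-agrees x₀ W F.pool (T₀⊆W₁ u∈)) (F.T⊆pool k v∈)

    pool⊆V : ∀ {v} → v ∈ leaves T₀ ++ F.pool → v ∈ V
    pool⊆V v∈ = [ (λ v∈T₀ → W⊆V (T₀⊆W (leaves-∈ T₀ v∈T₀)))
                , (λ v∈R → V₁⊆V (F.pool⊆V v∈R)) ]′ (∈-++⁻ (leaves T₀) v∈)

    extended : Family (suc i) P V
    extended = record
      { x         = λ { zero → x₀ ; (suc k) → F.x k }
      ; T         = λ { zero → T₀ ; (suc k) → F.T k }
      ; size-T    = λ { zero → size-T₀ ; (suc k) → F.size-T k }
      ; cotree-T  = λ { zero → cotree-T₀ ; (suc k) → F.cotree-T k }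
      ; trace-T   = λ { zero → same-trace ∘ T₀⊆W ; (suc k) → ∷-injectiveʳ ∘ F.trace-T k }
      ; joined-T  = λ { zero zero ne → contradiction refl ne
                      ; zero (suc k) _ → joined₀ k
                      ; (suc k) zero _ {u} {v} u∈ v∈ →
                          (λ eq → proj₁ (joined₀ k v∈ u∈) (≡-sym eq)) ,
                          trans (sym-adj u v) (trans (proj₂ (joined₀ k v∈ u∈)) (sym-adj x₀ (F.x k)))
                      ; (suc j) (suc k) ne → F.joined-T j k (ne ∘ cong suc) }
      ; pool      = leaves T₀ ++ F.pool
      ; pool-size = trans (length-++ (leaves T₀)) (cong₂ _+_ (trans (length-leaves T₀) size-T₀) F.pool-size)
      ; T⊆pool    = λ { zero → ∈-++⁺ˡ ∘ ∈-leaves ; (suc k) → ∈-++⁺ʳ (leaves T₀) ∘ F.T⊆pool k }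
      ; pool⊆V    = pool⊆V
      }

  -- `W` is the most popular trace class in `V`, `x₀` one of its vertices, and `V₁` keeps the
  -- vertices with few mismatches against `W`. Of the factor 4 in `room`, one 2 pays for `V` having
  -- perhaps only `n / 2` vertices, the other for the half of `W` lost in `clean-bound`.
  module Step {i p} (P : Vec (Fin N) p) (near : Near P) (p≤ : p + suc i ≤ M) (i≤ : suc i ≤ t)
              (V : List (Fin N)) (V⊆U : V ⊆ U) (big : (t + suc i) * n ≤ 2 * t * length V) where

    open ≤-Reasoning
    popular = popular-trace nosh P V
    q = proj₁ popular
    sb = sauerBound p e

    W = fibre (trace P) V q
    in-W : ∀ {u} → u ∈ W → u ∈ V × trace P u ≡ q
    in-W = ∈-filter⁻ (λ u → trace P u ≟ᵖ q) {xs = V}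
    W⊆U : W ⊆ U
    W⊆U = ⊆-trans (filter-⊆ (λ u → trace P u ≟ᵖ q) V) V⊆U

    n≤2V : n ≤ 2 * length V
    n≤2V = *-cancelˡ-≤ t {{>-nonZero 0<t}} (begin
      t * n               ≤⟨ *-monoˡ-≤ n (m≤m+n t (suc i)) ⟩
      (t + suc i) * n     ≤⟨ big ⟩
      2 * t * length V    ≡⟨ rearr t (length V) ⟩
      t * (2 * length V)  ∎)
      where
      rearr : ∀ t v → 2 * t * v ≡ t * (2 * v)
      rearr = solve-∀
    n≤sb : n ≤ sb * (2 * length W)
    n≤sb = begin
      n                   ≤⟨ n≤2V ⟩
      2 * length V        ≤⟨ *-monoʳ-≤ 2 (proj₂ popular) ⟩
      2 * (sb * length W) ≡⟨ rearr sb (length W) ⟩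
      sb * (2 * length W) ∎
      where
      rearr : ∀ s v → 2 * (s * v) ≡ s * (2 * v)
      rearr = solve-∀
    0<n : 0 < n
    0<n = ≤-trans (≤-trans (*-mono-≤ (*-mono-≤ {1} {4} (s≤s z≤n) 0<t) (*-mono-≤ (*-mono-≤ {1} {2} (s≤s z≤n) 0<t) 0<z))
                           (≤-reflexive (≡-sym D≡))) D≤
    instance
      -- A zero bound would force `n` to be zero in `n≤sb`.
      sb≢0 : NonZero sb
      sb≢0 = m*n≢0⇒m≢0 sb {{>-nonZero (≤-trans 0<n n≤sb)}}
    2w≤W : 2 * w ≤ length W
    2w≤W = *-cancelˡ-≤ 2 (*-cancelˡ-≤ sb (begin
      sb * (2 * (2 * w))  ≡⟨ cong (sb *_) (*-assoc 2 2 w) ⟨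
      sb * (4 * w)        ≤⟨ room (≤-trans (m≤m+n p (suc i)) p≤) ⟩
      n                   ≤⟨ n≤sb ⟩
      sb * (2 * length W) ∎))
    0<W : 0 < length W
    0<W = ≤-trans (*-mono-≤ {1} {2} (s≤s z≤n) 0<w) 2w≤W

    x₀ = proj₁ (nonempty W 0<W)
    x₀∈W = proj₂ (nonempty W 0<W)
    same-trace : ∀ {u} → u ∈ W → trace P u ≡ trace P x₀
    same-trace u∈ = trans (proj₂ (in-W u∈)) (≡-sym (proj₂ (in-W x₀∈W)))

    V₁ = filter (good? x₀ W) V
    V₁⊆V : V₁ ⊆ V
    V₁⊆V = filter-⊆ (good? x₀ W) V
    big₁ : (t + i) * n ≤ 2 * t * length V₁
    big₁ = +-cancelʳ-≤ (2 * t * b) _ _ (begin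
      (t + i) * n + 2 * t * b             ≤⟨ +-monoʳ-≤ ((t + i) * n) (bad-bound x₀ W W⊆U 0<W
                                               (λ u∈ → near (Sublist.lookup W⊆U u∈) (Sublist.lookup W⊆U x₀∈W) (same-trace u∈)) V⊆U) ⟩
      (t + i) * n + n                     ≡⟨ rearr t i n ⟩
      (t + suc i) * n                     ≤⟨ big ⟩
      2 * t * length V                    ≡⟨ cong (2 * t *_) (length-filter-¬ (good? x₀ W) V) ⟨
      2 * t * (length V₁ + b)             ≡⟨ *-distribˡ-+ (2 * t) (length V₁) b ⟩
      2 * t * length V₁ + 2 * t * b       ∎)
      where
      b = length (filter (¬? ∘ good? x₀ W) V)
      rearr : ∀ t i n → (t + i) * n + n ≡ (t + suc i) * n
      rearr = solve-∀

    near₁ : Near (x₀ ∷ P)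
    near₁ u∈ v∈ eq = near u∈ v∈ (∷-injectiveʳ eq)

    extend : Family i (x₀ ∷ P) V₁ → Family (suc i) P V
    extend = Extend.extended i≤ x₀ W W⊆U (proj₁ ∘ in-W) same-trace 2w≤W (Sublist.lookup V₁⊆V)
               (λ {v} → proj₂ ∘ ∈-filter⁻ (good? x₀ W) {xs = V})

  -- Each of the t steps discards at most n / 2t vertices, so n / 2 of them remain available:
  -- this is the invariant on V, where i is the number of steps left.
  family : ∀ i {p} (P : Vec (Fin N) p) → Near P → p + i ≤ M → i ≤ t →
           ∀ V → V ⊆ U → (t + i) * n ≤ 2 * t * length V → Family i P V
  family zero P near p≤ i≤ V V⊆U big = record
    { x = λ () ; T = λ () ; size-T = λ () ; cotree-T = λ () ; trace-T = λ () ; joined-T = λ ()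
    ; pool = [] ; pool-size = refl ; T⊆pool = λ () ; pool⊆V = λ () }
  family (suc i) {p} P near p≤ i≤ V V⊆U big =
    S.extend (family i (S.x₀ ∷ P) S.near₁ (≤-trans (≤-reflexive (≡-sym (+-suc p i))) p≤) (<⇒≤ i≤)
      S.V₁ (⊆-trans S.V₁⊆V V⊆U) S.big₁)
    where module S = Step P near p≤ i≤ V V⊆U big

-- The substitution step

HasCographs-mono : ∀ {e s n n′} → n ≤ n′ → HasCographs e s n → HasCographs e s n′
HasCographs-mono n≤n′ H adj sym-adj nosh U uU n′≤ = H adj sym-adj nosh U uU (≤-trans n≤n′ n′≤)

HasCographs-prune : ∀ {e s s′ n} → 0 < s′ → s′ ≤ s → HasCographs e s n → HasCographs e s′ n
HasCographs-prune 0<s′ s′≤s H adj sym-adj nosh U uU n≤ =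
  let τ , size-τ , cτ , τ⊆U = H adj sym-adj nosh U uU n≤
      σ , size-σ , cσ , σ⊆τ = prune _ τ 0<s′ (≤-trans s′≤s (≤-reflexive (≡-sym size-τ))) cτ
  in σ , size-σ , cσ , τ⊆U ∘ σ⊆τ

-- The product step bounds the number of vertices from above as well as from below, so longer lists
-- are first cut to length `n`.
HasCographs-exact : ∀ {e s n} →
  (∀ {N} (adj : Fin N → Fin N → Bool) → Symmetric adj → NoShatter adj e →
   (U : List (Fin N)) → Unique U → length U ≡ n → CotreeIn adj s U) → HasCographs e s n
HasCographs-exact {n = n} H adj sym-adj nosh U uU n≤ =
  let τ , size-τ , cτ , τ⊆ = H adj sym-adj nosh (take n U) (Unique.take⁺ n uU)
                               (trans (length-take n U) (m≤n⇒m⊓n≡m n≤))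
  in τ , size-τ , cτ , λ u∈ → Sublist.lookup (take-⊆ n U) (τ⊆ u∈)

-- Here `suc E` is the `D` of `Blocks`, whose own `E` is `2tz`. Trace vectors start as a net of
-- `E * q` vertices and grow by at most `t`, whence the bound on `p`. The outer cograph is found on
-- the indices of the family, and the trees are grafted into it.
HasCographs-product : ∀ {e s t z w n E q} → HasCographs e s t → HasCographs e z w →
  0 < t → 0 < z → 0 < w → 0 < E → suc E ≡ 4 * t * (2 * t * z) → suc E ≤ n → n * n < 2 ^ q →
  (∀ {p} → p ≤ E * q + t → sauerBound p e * (4 * w) ≤ n) → HasCographs e (s * z) n
HasCographs-product {e} {s} {t} {z} {w} {_} {E} {q} outer inner 0<t 0<z 0<w 0<E D≡ D≤ small room =
  HasCographs-exact λ { adj sym-adj nosh U uU refl → go adj sym-adj nosh U uU D≤ small room }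
  where
  go : ∀ {N} (adj : Fin N → Fin N → Bool) → Symmetric adj → NoShatter adj e →
       (U : List (Fin N)) → Unique U → suc E ≤ length U → length U * length U < 2 ^ q →
       (∀ {p} → p ≤ E * q + t → sauerBound p e * (4 * w) ≤ length U) → CotreeIn adj (s * z) U
  go {N} adj sym-adj nosh U uU D≤ small room =
    graft F.T σ , trans (size-graft F.T z F.size-T σ) (cong (_* z) size-σ) ,
    Cotree-graft F.T F.cotree-T F.joined-T σ cσ ,
    λ u∈ → let k , _ , u∈T = ∈-graft⁻ F.T σ u∈ in F.pool⊆V (F.T⊆pool k u∈T)
    where
    open Separation adj
    module B = Blocks adj sym-adj nosh U uU 0<t 0<z 0<w D≡ D≤ inner (E * q + t) room
    abstract
      sep : Σ (Vec (Fin N) (E * q)) B.Near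
      sep = net E q U 0<E (≤-trans (s≤s z≤n) D≤) small
      fam : B.Family t (proj₁ sep) U
      fam = B.family t (proj₁ sep) (proj₂ sep) ≤-refl ≤-refl U ⊆-refl
              (≤-reflexive (rearr t (length U)))
        where
        rearr : ∀ t n → (t + t) * n ≡ 2 * t * n
        rearr = solve-∀
    module F = B.Family fam
    reduced : CotreeIn (λ i j → adj (F.x i) (F.x j)) s (allFin t)
    reduced = outer _ (λ i j → sym-adj (F.x i) (F.x j)) (NoShatter-pullback F.x nosh)
      (allFin t) (Unique.allFin⁺ t) (≤-reflexive (≡-sym (length-tabulate {n = t} (λ i → i))))
    σ = proj₁ reduced
    size-σ = proj₁ (proj₂ reduced)
    cσ = proj₁ (proj₂ (proj₂ reduced))

-- Trace vectors will be shorter than `2 ^ (6 + 5 * a)`, so the Sauer bound costs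
-- `(6 + 5 * a) * d ≤ 11 * d * a` in the exponent. The further `6 * a` covers the factor 4 of `room`
-- and also `D = 2 ^ (3 + 3 * a)`.
cost : ℕ → ℕ
cost d = 11 * d + 6

2^-mono : ∀ {m n} → m ≤ n → 2 ^ m ≤ 2 ^ n
2^-mono = ^-monoʳ-≤ 2

0<2^ : ∀ n → 0 < 2 ^ n
0<2^ = m^n>0 2

-- `HasCographs-product` with `t = z = 2 ^ a` and `w = 2 ^ x`. The bound on the new exponent keeps
-- `q`, and with it the length of the net, polynomial in `2 ^ a`.
log-product : ∀ {d s a x} → 0 < a → HasCographs (suc d) (2 ^ s) (2 ^ a) →
  HasCographs (suc d) (2 ^ a) (2 ^ x) → x + cost d * a ≤ 2 ^ (2 * a) →
  HasCographs (suc d) (2 ^ (s + a)) (2 ^ (x + cost d * a))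
log-product {d} {s} {a} {x} 0<a outer inner X≤ = subst (λ k → HasCographs (suc d) k (2 ^ X)) (≡-sym (^-distribˡ-+-* 2 s a))
  (HasCographs-product {s = 2 ^ s} {E = E} {q} outer inner (0<2^ a) (0<2^ a) (0<2^ x) 0<E D≡ D≤ small room)
  where
  open ≤-Reasoning
  X = x + cost d * a
  q = 2 * X + 1
  D = 2 ^ (3 + 3 * a)
  E = pred D
  sucE≡D : suc E ≡ D
  sucE≡D = suc-pred D {{m^n≢0 2 (3 + 3 * a)}}
  0<E : 0 < E
  0<E = s≤s⁻¹ (begin
    2           ≤⟨ 2^-mono {1} {3 + 3 * a} (s≤s z≤n) ⟩
    D           ≡⟨ sucE≡D ⟨
    suc E       ∎)
  D≡ : suc E ≡ 4 * 2 ^ a * (2 * 2 ^ a * 2 ^ a)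
  D≡ = begin-equality
    suc E                                 ≡⟨ sucE≡D ⟩
    2 ^ (3 + 3 * a)                       ≡⟨ ^-distribˡ-+-* 2 3 (3 * a) ⟩
    8 * 2 ^ (3 * a)                       ≡⟨ cong (λ k → 8 * 2 ^ k) (*-comm 3 a) ⟩
    8 * 2 ^ (a * 3)                       ≡⟨ cong (8 *_) (^-*-assoc 2 a 3) ⟨
    8 * (2 ^ a) ^ 3                       ≡⟨ rearr (2 ^ a) ⟩
    4 * 2 ^ a * (2 * 2 ^ a * 2 ^ a)       ∎
    where
    rearr : ∀ y → 8 * (y * (y * (y * 1))) ≡ 4 * y * (2 * y * y)
    rearr = solve-∀
  D≤ : suc E ≤ 2 ^ X
  D≤ = ≤-trans (≤-reflexive sucE≡D) (2^-mono (begin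
    3 + 3 * a              ≤⟨ +-monoˡ-≤ (3 * a) (*-monoʳ-≤ 3 0<a) ⟩
    3 * a + 3 * a          ≡⟨ *-distribʳ-+ a 3 3 ⟨
    6 * a                  ≤⟨ *-monoˡ-≤ a (m≤n+m 6 (11 * d)) ⟩
    cost d * a             ≤⟨ m≤n+m (cost d * a) x ⟩
    X                      ∎))
  small : 2 ^ X * 2 ^ X < 2 ^ q
  small = begin-strict
    2 ^ X * 2 ^ X   ≡⟨ ^-distribˡ-+-* 2 X X ⟨
    2 ^ (X + X)     <⟨ ^-monoʳ-< 2 (s≤s (s≤s z≤n)) (≤-reflexive (rearr X)) ⟩
    2 ^ q           ∎
    where
    rearr : ∀ X → suc (X + X) ≡ 2 * X + 1
    rearr = solve-∀
  q≤ : q ≤ 2 ^ (2 + 2 * a)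
  q≤ = begin
    2 * X + 1               ≤⟨ +-mono-≤ (*-monoʳ-≤ 2 X≤) (0<2^ (2 * a)) ⟩
    2 * 2 ^ (2 * a) + 2 ^ (2 * a) ≡⟨ +-comm (2 * 2 ^ (2 * a)) _ ⟩
    3 * 2 ^ (2 * a)         ≤⟨ *-monoˡ-≤ (2 ^ (2 * a)) (n≤1+n 3) ⟩
    4 * 2 ^ (2 * a)         ≡⟨ ^-distribˡ-+-* 2 2 (2 * a) ⟨
    2 ^ (2 + 2 * a)         ∎
  p≤ : suc (E * q + 2 ^ a) ≤ 2 ^ (6 + 5 * a)
  p≤ = begin
    suc (E * q) + 2 ^ a                        ≤⟨ +-monoˡ-≤ (2 ^ a) (+-monoˡ-≤ (E * q) (m≤n+m 1 (2 * X))) ⟩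
    suc E * q + 2 ^ a                          ≡⟨ cong (λ k → k * q + 2 ^ a) sucE≡D ⟩
    D * q + 2 ^ a                              ≤⟨ +-mono-≤ (*-monoʳ-≤ D q≤) (2^-mono a≤) ⟩
    D * 2 ^ (2 + 2 * a) + 2 ^ (5 + 5 * a)      ≡⟨ cong (_+ 2 ^ (5 + 5 * a)) (^-distribˡ-+-* 2 (3 + 3 * a) (2 + 2 * a)) ⟨
    2 ^ (3 + 3 * a + (2 + 2 * a)) + 2 ^ (5 + 5 * a) ≡⟨ cong (λ k → 2 ^ k + 2 ^ (5 + 5 * a)) (rearr a) ⟩
    2 ^ (5 + 5 * a) + 2 ^ (5 + 5 * a)          ≡⟨ cong (2 ^ (5 + 5 * a) +_) (+-identityʳ _) ⟨
    2 ^ (6 + 5 * a)                            ∎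
    where
    rearr : ∀ a → 3 + 3 * a + (2 + 2 * a) ≡ 5 + 5 * a
    rearr = solve-∀
    a≤ : a ≤ 5 + 5 * a
    a≤ = ≤-trans (m≤m+n a (4 * a)) (m≤n+m (5 * a) 5)
  room : ∀ {p} → p ≤ E * q + 2 ^ a → sauerBound p (suc d) * (4 * 2 ^ x) ≤ 2 ^ X
  room {p} p≤′ = begin
    sauerBound p (suc d) * (4 * 2 ^ x)         ≤⟨ *-monoˡ-≤ (4 * 2 ^ x) (sauerBound-≤ p d) ⟩
    suc p ^ d * (4 * 2 ^ x)                    ≤⟨ *-monoˡ-≤ (4 * 2 ^ x) (^-monoˡ-≤ d (≤-trans (s≤s p≤′) p≤)) ⟩
    (2 ^ (6 + 5 * a)) ^ d * (4 * 2 ^ x)        ≡⟨ cong₂ _*_ (^-*-assoc 2 (6 + 5 * a) d) (≡-sym (^-distribˡ-+-* 2 2 x)) ⟩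
    2 ^ ((6 + 5 * a) * d) * 2 ^ (2 + x)        ≡⟨ ^-distribˡ-+-* 2 ((6 + 5 * a) * d) (2 + x) ⟨
    2 ^ ((6 + 5 * a) * d + (2 + x))            ≤⟨ 2^-mono exponent ⟩
    2 ^ X                                      ∎
    where
    rearr : ∀ a d x → (6 * a + 5 * a) * d + (6 * a + x) ≡ x + (11 * d + 6) * a
    rearr = solve-∀
    exponent : (6 + 5 * a) * d + (2 + x) ≤ X
    exponent = begin
      (6 + 5 * a) * d + (2 + x)           ≤⟨ +-mono-≤ (*-monoˡ-≤ d (+-monoˡ-≤ (5 * a) (*-monoʳ-≤ 6 0<a)))
                                               (+-monoˡ-≤ x (≤-trans (s≤s (s≤s z≤n)) (*-monoʳ-≤ 6 0<a))) ⟩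
      (6 * a + 5 * a) * d + (6 * a + x)   ≡⟨ rearr a d x ⟩
      X                                   ∎

-- Growth of the cographs

-- As in the simplest proof of Ramsey's theorem, the first vertex is attached to a cograph found in
-- its neighbourhood or in its non-neighbourhood, whichever is large enough.
caterpillar : ∀ {e} m → HasCographs e (suc m) (2 ^ m)
caterpillar zero adj sym-adj nosh (v ∷ U) uU n≤ = leaf v , refl , tt , λ { here → here refl }
caterpillar (suc m) adj sym-adj nosh (v ∷ U) (v∉U ∷ uU) n≤ =
  [ attach true A? (λ h → h) , attach false (¬? ∘ A?) ¬-not ]′ (half sizes)
  where
  open ≤-Reasoning
  A? : ∀ u → Dec (adj v u ≡ true)
  A? u = adj v u Bool.≟ true
  a = length (filter A? U)
  b = length (filter (¬? ∘ A?) U)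
  sizes : 2 ^ m + 2 ^ m ≤ suc (a + b)
  sizes = begin
    2 ^ m + 2 ^ m        ≡⟨ cong (2 ^ m +_) (+-identityʳ (2 ^ m)) ⟨
    2 ^ suc m            ≤⟨ n≤ ⟩
    suc (length U)       ≡⟨ cong suc (length-filter-¬ A? U) ⟨
    suc (a + b)          ∎
  -- Without `v` at least `2 ^ suc m - 1` vertices are left, while two parts below `2 ^ m` hold at
  -- most `2 ^ suc m - 2`.
  half : 2 ^ m + 2 ^ m ≤ suc (a + b) → 2 ^ m ≤ a ⊎ 2 ^ m ≤ b
  half h with 2 ^ m ≤? a | 2 ^ m ≤? b
  ... | yes p | _     = inj₁ p
  ... | no _  | yes q = inj₂ q
  ... | no p  | no q  = contradiction h (<⇒≱ (s≤s⁻¹ (≤-trans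
        (≤-reflexive (cong suc (≡-sym (+-suc (suc a) b)))) (s≤s (+-mono-≤ (≰⇒> p) (≰⇒> q))))))
  attach : ∀ c {P : Fin _ → Set} (P? : ∀ u → Dec (P u)) → (∀ {u} → P u → adj v u ≡ c) →
           2 ^ m ≤ length (filter P? U) → CotreeIn adj (suc (suc m)) (v ∷ U)
  attach c P? P⇒c big =
    let τ , size-τ , cτ , τ⊆ = caterpillar m adj sym-adj nosh (filter P? U) (unique-⊆ (filter-⊆ P? U) uU) big
    in node c (leaf v) τ , cong suc size-τ ,
       (tt , cτ , λ { here u∈ → (λ { refl → All.lookup v∉U (proj₁ (∈-filter⁻ P? {xs = U} (τ⊆ u∈))) refl }) ,
                                P⇒c (proj₂ (∈-filter⁻ P? {xs = U} (τ⊆ u∈))) }) ,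
       λ { (left here) → here refl ; (right u∈) → there (proj₁ (∈-filter⁻ P? {xs = U} (τ⊆ u∈))) }
caterpillar zero    adj sym-adj nosh [] uU ()
caterpillar (suc m) adj sym-adj nosh [] uU n≤ = contradiction (≤-trans (0<2^ (suc m)) n≤) λ ()

-- The property P (s , x) of the outline.
LogCographs : (e s x : ℕ) → Set
LogCographs e s x = HasCographs e (2 ^ s) (2 ^ x)

log-mono : ∀ {e s s′ x x′} → s′ ≤ s → x ≤ x′ → LogCographs e s x → LogCographs e s′ x′
log-mono {e} {s} {s′} s′≤s x≤x′ =
  HasCographs-mono {s = 2 ^ s′} (2^-mono x≤x′) ∘ HasCographs-prune {s = 2 ^ s} (0<2^ s′) (2^-mono s′≤s)

log-crude : ∀ {e} s → LogCographs e s (2 ^ s)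
log-crude s = HasCographs-prune (0<2^ s) (n≤1+n (2 ^ s)) (caterpillar (2 ^ s))

-- Repeats `log-product` with the same `s`, weakening `outer` to the current exponent. `A` bounds
-- every exponent met, so each round adds `s` on one side and at most `cost d * A` on the other.
log-iterate : ∀ {d s a x} q A → 0 < a → LogCographs (suc d) s a → LogCographs (suc d) a x →
              a + q * s ≤ A → x + q * (cost d * A) ≤ 2 ^ (2 * a) →
              LogCographs (suc d) (a + q * s) (x + q * (cost d * A))
log-iterate {a = a} {x} zero A 0<a outer inner _ _ =
  log-mono (≤-reflexive (+-identityʳ a)) (≤-reflexive (≡-sym (+-identityʳ x))) inner
log-iterate {d} {s} {a} {x} (suc q) A 0<a outer inner a≤A x≤ =
  log-mono (≤-reflexive (rearr a q s)) grow
    (log-product {s = s} {a′} {x′} (≤-trans 0<a a≤a′) (log-mono {s = s} ≤-refl a≤a′ outer) previous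
      (≤-trans grow (≤-trans x≤ (2^-mono (*-monoʳ-≤ 2 a≤a′)))))
  where
  open ≤-Reasoning
  rearr : ∀ a q s → a + suc q * s ≡ s + (a + q * s)
  rearr = solve-∀
  a′ = a + q * s
  x′ = x + q * (cost d * A)
  a≤a′ : a ≤ a′
  a≤a′ = m≤m+n a (q * s)
  a′≤A : a′ ≤ A
  a′≤A = ≤-trans (+-monoʳ-≤ a (m≤n+m (q * s) s)) a≤A
  grow : x′ + cost d * a′ ≤ x + suc q * (cost d * A)
  grow = begin
    x′ + cost d * a′           ≤⟨ +-monoʳ-≤ x′ (*-monoʳ-≤ (cost d) a′≤A) ⟩
    x′ + cost d * A            ≡⟨ rearr′ x (q * (cost d * A)) (cost d * A) ⟩
    x + suc q * (cost d * A)   ∎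
    where
    rearr′ : ∀ x y z → x + y + z ≡ x + (z + y)
    rearr′ = solve-∀
  previous : LogCographs (suc d) a′ x′
  previous = log-iterate q A 0<a outer inner a′≤A
    (≤-trans (+-monoʳ-≤ x (m≤n+m (q * (cost d * A)) (cost d * A))) x≤)

n≤2^n : ∀ n → suc n ≤ 2 ^ n
n≤2^n zero    = ≤-refl
n≤2^n (suc n) = begin
  suc (suc n)      ≤⟨ s≤s (n≤2^n n) ⟩
  suc (2 ^ n)      ≤⟨ +-monoˡ-≤ (2 ^ n) (0<2^ n) ⟩
  2 ^ n + 2 ^ n    ≡⟨ cong (2 ^ n +_) (+-identityʳ (2 ^ n)) ⟨
  2 ^ suc n        ∎
  where open ≤-Reasoning

-- Induction on j: halve r and use (i + 1)ʲ⁺¹ = (i + 1)ʲ (i + 1) ≤ 2ⁱ 2ⁱ.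
poly≤exp : ∀ M j → ∃ λ r₀ → ∀ {r} → r₀ ≤ r → M * suc r ^ j ≤ 2 ^ r
poly≤exp M zero    = M , λ {r} M≤r → begin
  M * 1   ≡⟨ *-identityʳ M ⟩
  M       ≤⟨ M≤r ⟩
  r       ≤⟨ n≤1+n r ⟩
  suc r   ≤⟨ n≤2^n r ⟩
  2 ^ r   ∎
  where open ≤-Reasoning
poly≤exp M (suc j) with r₀ , h ← poly≤exp (M * 2 ^ suc j) j = 2 * r₀ , λ {r} → bound h r
  where
  open ≤-Reasoning
  bound : ∀ {r₀} → (∀ {r} → r₀ ≤ r → M * 2 ^ suc j * suc r ^ j ≤ 2 ^ r) →
          ∀ r → 2 * r₀ ≤ r → M * suc r ^ suc j ≤ 2 ^ r
  bound {r₀} h r 2r₀≤r = begin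
    M * suc r ^ suc j                        ≤⟨ *-monoʳ-≤ M (^-monoˡ-≤ (suc j) suc-r≤) ⟩
    M * (2 * suc i) ^ suc j                  ≡⟨ cong (M *_) (^-*ˡ 2 (suc i) (suc j)) ⟩
    M * (2 ^ suc j * (suc i * suc i ^ j))    ≡⟨ rearr M (2 ^ suc j) (suc i) (suc i ^ j) ⟩
    M * 2 ^ suc j * suc i ^ j * suc i        ≤⟨ *-mono-≤ (h r₀≤i) (n≤2^n i) ⟩
    2 ^ i * 2 ^ i                            ≡⟨ ^-distribˡ-+-* 2 i i ⟨
    2 ^ (i + i)                              ≤⟨ 2^-mono i+i≤r ⟩
    2 ^ r                                    ∎
    where
    i = ⌊ r /2⌋
    rearr : ∀ a b c d → a * (b * (c * d)) ≡ a * b * d * c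
    rearr = solve-∀
    i+i≤r : i + i ≤ r
    i+i≤r = ≤-trans (+-monoʳ-≤ i (⌊n/2⌋≤⌈n/2⌉ r)) (≤-reflexive (⌊n/2⌋+⌈n/2⌉≡n r))
    r₀≤i : r₀ ≤ i
    r₀≤i = ≤-trans (≤-reflexive (n≡⌊n+n/2⌋ r₀)) (⌊n/2⌋-mono (≤-trans (≤-reflexive (cong (r₀ +_) (≡-sym (+-identityʳ r₀)))) 2r₀≤r))
    ⌈/2⌉≤ : ∀ n → ⌈ n /2⌉ ≤ suc ⌊ n /2⌋
    ⌈/2⌉≤ zero          = z≤n
    ⌈/2⌉≤ (suc zero)    = ≤-refl
    ⌈/2⌉≤ (suc (suc n)) = s≤s (⌈/2⌉≤ n)
    suc-r≤ : suc r ≤ 2 * suc i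
    suc-r≤ = begin
      suc r                ≡⟨ cong suc (⌊n/2⌋+⌈n/2⌉≡n r) ⟨
      suc (i + ⌈ r /2⌉)    ≤⟨ s≤s (+-monoʳ-≤ i (⌈/2⌉≤ r)) ⟩
      suc i + suc i        ≡⟨ cong (suc i +_) (+-identityʳ (suc i)) ⟨
      2 * suc i            ∎

-- A discrete derivative: `g` depends on `k` alone, which fixes the number of rounds between
-- consecutive `r` in `growth-suc`.
suc-^-≤ : ∀ k → ∃ λ g → ∀ {r} → 0 < r → suc r ^ suc k ≤ r ^ suc k + g * r ^ k
suc-^-≤ zero    = 1 , λ {r} _ → ≤-reflexive (rearr r)
  where
  rearr : ∀ r → suc r * 1 ≡ r * 1 + 1 * 1
  rearr = solve-∀
suc-^-≤ (suc k) with g , h ← suc-^-≤ k = 1 + 2 * g , λ {r} 0<r → begin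
  suc r * suc r ^ suc k                   ≤⟨ *-monoʳ-≤ (suc r) (h 0<r) ⟩
  suc r * (r * r ^ k + g * r ^ k)         ≡⟨ rearr r (r ^ k) g ⟩
  r * (r * r ^ k) + (1 + g) * (r * r ^ k) + g * (1 * r ^ k)
                                          ≤⟨ +-monoʳ-≤ (r * (r * r ^ k) + (1 + g) * (r * r ^ k)) (*-monoʳ-≤ g (*-monoˡ-≤ (r ^ k) 0<r)) ⟩
  r * (r * r ^ k) + (1 + g) * (r * r ^ k) + g * (r * r ^ k)
                                          ≡⟨ rearr′ (r * (r * r ^ k)) (r * r ^ k) g ⟩
  r * (r * r ^ k) + (1 + 2 * g) * (r * r ^ k) ∎
  where
  open ≤-Reasoning
  rearr : ∀ r p g → suc r * (r * p + g * p) ≡ r * (r * p) + (1 + g) * (r * p) + g * (1 * p)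
  rearr = solve-∀
  rearr′ : ∀ x y g → x + (1 + g) * y + g * y ≡ x + (1 + 2 * g) * y
  rearr′ = solve-∀

Growth : ℕ → ℕ → Set
Growth d k = ∃ λ c → ∃ λ r₀ → 0 < c × (∀ {r} → r₀ ≤ r → LogCographs (suc d) (r ^ k) (c * r ^ suc k))

-- Passing from `a r` to `a (suc r)` takes `q = c * g` rounds with outer exponent `r ^ k`, each
-- costing a constant times `r ^ suc k`. Summed over all smaller arguments this is a constant times
-- `r ^ suc (suc k)`. The climb starts at `r₂` with `log-crude`.
growth-suc : ∀ {d k} → Growth d k → Growth d (suc k)
growth-suc {d} {k} (c , r₀ , 0<c , outer) =
  K + M , r₂ , ≤-trans (0<2^ (a r₂)) (m≤m+n K M) , λ {r} r₂≤r →
    log-mono {s = a r} (m≤n*m (r ^ suc k) c) (conclude r r₂≤r) (reach r r₂≤r)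
  where
  open ≤-Reasoning
  instance
    c≢0 : NonZero c
    c≢0 = >-nonZero 0<c
  g : ℕ
  g = proj₁ (suc-^-≤ k)
  q = c * g
  -- `M * r ^ suc k` is the cost of the `q` rounds at `r`, where every exponent is at most
  -- `c * (1 + g) * r ^ suc k`.
  M = q * (cost d * (c * (1 + g)))
  r₁ : ℕ
  r₁ = proj₁ (poly≤exp M (suc (suc k)))
  r₂ = suc (r₀ + r₁)
  a : ℕ → ℕ
  a r = c * r ^ suc k
  K = 2 ^ a r₂

  a-mono : ∀ {r r′} → r ≤ r′ → a r ≤ a r′
  a-mono r≤r′ = *-monoʳ-≤ c (^-monoˡ-≤ (suc k) r≤r′)

  step : ∀ r → r₂ ≤ r → LogCographs (suc d) (a r) (K + M * r ^ suc (suc k)) →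
         LogCographs (suc d) (a (suc r)) (K + M * suc r ^ suc (suc k))
  step r r₂≤r inner = log-mono a-suc x-suc
    (log-iterate {s = r ^ k} q A 0<a (outer (≤-trans (≤-trans (m≤m+n r₀ r₁) (n≤1+n _)) r₂≤r)) inner
      a≤A (≤-trans x-suc room))
    where
    R = r ^ k
    A = c * (1 + g) * r ^ suc k
    0<r : 0 < r
    0<r = ≤-trans (s≤s z≤n) r₂≤r
    instance
      r≢0 : NonZero r
      r≢0 = >-nonZero 0<r
    r≤a : r ≤ a r
    r≤a = begin
      r              ≡⟨ *-identityʳ r ⟨
      r * 1          ≤⟨ *-monoʳ-≤ r (m^n>0 r k) ⟩
      r ^ suc k      ≤⟨ m≤n*m (r ^ suc k) c ⟩
      a r            ∎
    0<a : 0 < a r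
    0<a = ≤-trans 0<r r≤a
    a≤A : a r + q * R ≤ A
    a≤A = begin
      c * r ^ suc k + c * g * R            ≤⟨ +-monoʳ-≤ (a r) (*-monoʳ-≤ q (m≤n*m R r)) ⟩
      c * r ^ suc k + c * g * r ^ suc k    ≡⟨ rearr c g (r ^ suc k) ⟩
      A                                    ∎
      where
      rearr : ∀ c g s → c * s + c * g * s ≡ c * (1 + g) * s
      rearr = solve-∀
    a-suc : a (suc r) ≤ a r + q * R
    a-suc = begin
      c * suc r ^ suc k              ≤⟨ *-monoʳ-≤ c (proj₂ (suc-^-≤ k) 0<r) ⟩
      c * (r ^ suc k + g * R)        ≡⟨ rearr c (r ^ suc k) g R ⟩
      a r + q * R                    ∎
      where
      rearr : ∀ c s g R → c * (s + g * R) ≡ c * s + c * g * R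
      rearr = solve-∀
    x-suc : K + M * r ^ suc (suc k) + q * (cost d * A) ≤ K + M * suc r ^ suc (suc k)
    x-suc = begin
      K + M * (r * r ^ suc k) + q * (cost d * (c * (1 + g) * r ^ suc k))
        ≡⟨ rearr K q (cost d) (c * (1 + g)) r (r ^ suc k) ⟩
      K + M * (suc r * r ^ suc k)
        ≤⟨ +-monoʳ-≤ K (*-monoʳ-≤ M (*-monoʳ-≤ (suc r) (^-monoˡ-≤ (suc k) (n≤1+n r)))) ⟩
      K + M * suc r ^ suc (suc k) ∎
      where
      rearr : ∀ K q C y r s → K + q * (C * y) * (r * s) + q * (C * (y * s)) ≡ K + q * (C * y) * (suc r * s)
      rearr = solve-∀
    -- Both summands are at most `2 ^ a r`: the first by `r₂ ≤ r`, the second since `r` is past the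
    -- threshold `r₁`.
    room : K + M * suc r ^ suc (suc k) ≤ 2 ^ (2 * a r)
    room = begin
      K + M * suc r ^ suc (suc k)    ≤⟨ +-mono-≤ (2^-mono (a-mono r₂≤r))
                                          (proj₂ (poly≤exp M (suc (suc k))) (≤-trans (≤-trans (m≤n+m r₁ r₀) (n≤1+n _)) r₂≤r)) ⟩
      2 ^ a r + 2 ^ r                ≤⟨ +-monoʳ-≤ (2 ^ a r) (2^-mono r≤a) ⟩
      2 ^ a r + 2 ^ a r              ≡⟨ cong (2 ^ a r +_) (+-identityʳ (2 ^ a r)) ⟨
      2 ^ (1 + a r)                  ≤⟨ 2^-mono (+-monoˡ-≤ (a r) 0<a) ⟩
      2 ^ (a r + a r)                ≡⟨ cong (λ y → 2 ^ (a r + y)) (+-identityʳ (a r)) ⟨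
      2 ^ (2 * a r)                  ∎

  reach′ : ∀ i → LogCographs (suc d) (a (i + r₂)) (K + M * (i + r₂) ^ suc (suc k))
  reach′ zero    = log-mono {s = a r₂} ≤-refl (m≤m+n K _) (log-crude (a r₂))
  reach′ (suc i) = step (i + r₂) (m≤n+m r₂ i) (reach′ i)

  reach : ∀ r → r₂ ≤ r → LogCographs (suc d) (a r) (K + M * r ^ suc (suc k))
  reach r r₂≤r = subst (λ r → LogCographs (suc d) (a r) (K + M * r ^ suc (suc k)))
                       (m∸n+n≡m r₂≤r) (reach′ (r ∸ r₂))

  conclude : ∀ r → r₂ ≤ r → K + M * r ^ suc (suc k) ≤ (K + M) * r ^ suc (suc k)
  conclude r r₂≤r = begin
    K + M * r ^ suc (suc k)                      ≤⟨ +-monoˡ-≤ _ (m≤m*n K (r ^ suc (suc k)) {{m^n≢0 r (suc (suc k)) {{>-nonZero (≤-trans (s≤s z≤n) r₂≤r)}}}}) ⟩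
    K * r ^ suc (suc k) + M * r ^ suc (suc k)    ≡⟨ *-distribʳ-+ (r ^ suc (suc k)) K M ⟨
    (K + M) * r ^ suc (suc k)                    ∎

growth : ∀ d k → Growth d k
-- For `k = 0` only a cograph on `2 ^ 1` vertices is asked for.
growth d zero    = 1 , 1 , s≤s z≤n , λ {r} 1≤r →
  HasCographs-mono (2^-mono (≤-trans 1≤r (≤-reflexive (rearr r)))) (caterpillar 1)
  where
  rearr : ∀ r → r ≡ 1 * (r * 1)
  rearr = solve-∀
growth d (suc k) = growth-suc {d} {k} (growth d k)

-- Graphs and subsets

module _ {n : ℕ} where

  fromList : List (Fin n) → Subset n
  fromList []       = Subset.⊥
  fromList (x ∷ xs) = ⁅ x ⁆ ∪ fromList xs

  ∈-fromList⁻ : ∀ xs {v} → v Subset.∈ fromList xs → v ∈ xs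
  ∈-fromList⁻ []       v∈ = contradiction v∈ ∉⊥
  ∈-fromList⁻ (x ∷ xs) v∈ = [ here ∘ x∈⁅y⁆⇒x≡y x , there ∘ ∈-fromList⁻ xs ]′ (x∈p∪q⁻ ⁅ x ⁆ (fromList xs) v∈)

  length≤∣fromList∣ : ∀ {xs} → Unique xs → length xs ≤ ∣ fromList xs ∣
  length≤∣fromList∣ []                  = z≤n
  length≤∣fromList∣ {x ∷ xs} (x∉ ∷ uxs) = ≤-trans (s≤s (length≤∣fromList∣ uxs)) (p⊂q⇒∣p∣<∣q∣
    (q⊆p∪q ⁅ x ⁆ (fromList xs) , x , x∈p∪q⁺ (inj₁ (x∈⁅x⁆ x)) ,
     λ x∈ → All.lookup x∉ (∈-fromList⁻ xs x∈) refl))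

  ∈-toList⁻ : ∀ {m} (ys : Vec (Fin n) m) {v} → v ∈ Vec.toList ys → ∃ λ i → lookup ys i ≡ v
  ∈-toList⁻ (y ∷ ys) (here refl) = zero , refl
  ∈-toList⁻ (y ∷ ys) (there v∈)  = let i , eq = ∈-toList⁻ ys v∈ in suc i , eq

  lookup-from-map : ∀ {m} {f : Fin n → Bool} (ys : Vec (Fin n) m) {bs} i → Vec.map f ys ≡ bs →
                    f (lookup ys i) ≡ lookup bs i
  lookup-from-map {f = f} ys i refl = ≡-sym (lookup-map i f ys)

  -- The pattern that is true at the head and false elsewhere tells the head from all later entries.
  unique-shattered : ∀ {m} (ys : Vec (Fin n) m) →
                     ((bs : Vec Bool m) → ∃ λ (f : Fin n → Bool) → Vec.map f ys ≡ bs) →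
                     Unique (Vec.toList ys)
  unique-shattered []       sh = []
  unique-shattered (y ∷ ys) sh = All.tabulate fresh ∷ unique-shattered ys λ bs →
      let f , eq = sh (true ∷ bs) in f , ∷-injectiveʳ eq
    where
    fresh : ∀ {v} → v ∈ Vec.toList ys → y ≢ v
    fresh v∈ refl with i , refl ← ∈-toList⁻ ys v∈ | f , eq ← sh (true ∷ Vec.replicate _ false) =
      contradiction
        (trans (≡-sym (∷-injectiveˡ eq)) (trans (lookup-from-map ys i (∷-injectiveʳ eq)) (lookup-replicate i false)))
        λ ()

-- A shattered vector of length `suc d` has distinct entries, so its entries would form a shattered
-- set with more than `d` elements.
VCdim≤⇒NoShatter : ∀ {n d} {G : Graph n} → VCdim≤ G d → NoShatter (adj G) (suc d)
VCdim≤⇒NoShatter {n} {d} {G} vc ys sh = contradiction (begin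
  suc d                              ≡⟨ length-toList ys ⟨
  length (Vec.toList ys)             ≤⟨ length≤∣fromList∣ (unique-shattered ys λ bs → let v , eq = sh bs in adj G v , eq) ⟩
  ∣ fromList (Vec.toList ys) ∣       ≤⟨ vc _ shattered ⟩
  d                                  ∎) (<⇒≱ (n<1+n d))
  where
  open ≤-Reasoning
  shattered : Shattered G (fromList (Vec.toList ys))
  shattered B _ with v , eq ← sh (Vec.map (lookup B) ys) = v , λ u u∈ → agree u (∈-toList⁻ ys (∈-fromList⁻ (Vec.toList ys) u∈))
    where
    agree : ∀ u → (∃ λ i → lookup ys i ≡ u) →
            (u Subset.∈ B → InNbhd G v u) × (InNbhd G v u → u Subset.∈ B)
    agree u (i , refl) = (λ u∈B → trans same ([]=⇒lookup u∈B)) ,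
                         (λ nb → lookup⇒[]= u B (trans (≡-sym same) nb))
      where
      same : adj G v u ≡ lookup B u
      same = trans (lookup-from-map ys i eq) (lookup-map i (lookup B) ys)

-- Binary logarithms and the deduction of the theorem

2^⌊log₂⌋≤ : ∀ n → 0 < n → 2 ^ ⌊log₂ n ⌋ ≤ n
2^⌊log₂⌋≤ = <-rec _ λ where
    (suc zero)      rec _ → ≤-refl
    n@(suc (suc m)) rec _ → begin
      2 ^ ⌊log₂ n ⌋                      ≤⟨ 2^-mono (m≤n+m∸n ⌊log₂ n ⌋ 1) ⟩
      2 * 2 ^ (⌊log₂ n ⌋ ∸ 1)            ≡⟨ cong (λ k → 2 * 2 ^ k) (⌊log₂⌊n/2⌋⌋≡⌊log₂n⌋∸1 n) ⟨
      2 * 2 ^ ⌊log₂ ⌊ n /2⌋ ⌋            ≤⟨ *-monoʳ-≤ 2 (rec (⌊n/2⌋<n (suc m)) z<s) ⟩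
      2 * ⌊ n /2⌋                        ≡⟨ cong (⌊ n /2⌋ +_) (+-identityʳ ⌊ n /2⌋) ⟩
      ⌊ n /2⌋ + ⌊ n /2⌋                  ≤⟨ +-monoʳ-≤ ⌊ n /2⌋ (⌊n/2⌋≤⌈n/2⌉ n) ⟩
      ⌊ n /2⌋ + ⌈ n /2⌉                  ≡⟨ ⌊n/2⌋+⌈n/2⌉≡n n ⟩
      n                                  ∎
  where open ≤-Reasoning

-- The search descends from `i + q₀`, where `f` is above `L`, and `low` stops it at `q₀` at the
-- latest.
bracket : ∀ (f : ℕ → ℕ) {L q₀} → f q₀ ≤ L → ∀ i → L < f (i + q₀) →
          ∃ λ q → q₀ ≤ q × f q ≤ L × L < f (suc q)
bracket f {L} {q₀} low zero    high = contradiction low (<⇒≱ high)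
bracket f {L} {q₀} low (suc i) high with f (i + q₀) ≤? L
... | yes le = i + q₀ , m≤n+m q₀ i , le , high
... | no ¬le = bracket f low i (≰⇒> ¬le)

-- The inequality says that the logarithm of the size is at least the power `k / (k + 1)` of the
-- logarithm of `n`. As `k` is arbitrary, letting it grow slowly with `n` gives the exponent
-- `1 - o(1)`, which also absorbs the base 2 and the rounding.
theorem1 : (d : ℕ) → 1 ≤ d → (k : ℕ) →
    Σ ℕ λ N → (n : ℕ) → N ≤ n → (G : Graph n) → VCdim≤ G d →
    Σ (Subset n) λ S → (IsClique G S ⊎ IsIndependent G S) ×
    (⌊log₂ n ⌋ ^ k ≤ ⌊log₂ ∣ S ∣ ⌋ ^ suc k)
theorem1 d _ k = 2 ^ f q₀ , λ n N≤n G vc → large n N≤n G (VCdim≤⇒NoShatter {G = G} vc)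
  where
  open ≤-Reasoning
  -- The exponent `(k + 1) / (k + 2)` exceeds `k / (k + 1)`, and the gap absorbs the constants.
  gr = growth d (suc k)
  c = proj₁ gr
  r₀ = proj₁ (proj₂ gr)
  0<c : 0 < c
  0<c = proj₁ (proj₂ (proj₂ gr))
  cographs : ∀ {r} → r₀ ≤ r → LogCographs (suc d) (r ^ suc k) (c * r ^ suc (suc k))
  cographs = proj₂ (proj₂ (proj₂ gr))
  -- Taking `r = 2 * q` makes the cograph exponent at least twice `q ^ suc k`, which pays for the
  -- square root lost in passing to a clique or an independent set.
  f : ℕ → ℕ
  f q = c * (2 * q) ^ suc (suc k)
  -- By `2 * suc q ≤ 4 * q`, `f (suc q)` is at most `B * q ^ suc (suc k)`. The factor `B ^ k` in its
  -- `k`-th power is at most `q`, and `(k + 2) * k + 1 = (k + 1) * (k + 1)`.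
  B = c * 4 ^ suc (suc k)
  q₀ = suc (r₀ + B ^ k)

  q≤f : ∀ q → q ≤ f q
  q≤f zero      = z≤n
  q≤f q@(suc _) = begin
    q                          ≤⟨ m≤n*m q 2 ⟩
    2 * q                      ≡⟨ *-identityʳ (2 * q) ⟨
    2 * q * 1                  ≤⟨ *-monoʳ-≤ (2 * q) (m^n>0 (2 * q) (suc k)) ⟩
    (2 * q) ^ suc (suc k)      ≤⟨ m≤n*m _ c {{>-nonZero 0<c}} ⟩
    f q                        ∎

  exponent : ∀ {L q} → q₀ ≤ q → L < f (suc q) → L ^ k ≤ (q ^ suc k) ^ suc k
  exponent {L} {q} q₀≤q L< = begin
    L ^ k                                        ≤⟨ ^-monoˡ-≤ k L≤ ⟩
    (B * q ^ suc (suc k)) ^ k                    ≡⟨ ^-*ˡ B (q ^ suc (suc k)) k ⟩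
    B ^ k * (q ^ suc (suc k)) ^ k                ≤⟨ *-mono-≤ (≤-trans (≤-trans (m≤n+m (B ^ k) r₀) (n≤1+n _)) q₀≤q)
                                                     (≤-reflexive (^-*-assoc q (suc (suc k)) k)) ⟩
    q ^ suc (suc (suc k) * k)                    ≡⟨ cong (q ^_) (rearr k) ⟩
    q ^ (suc k * suc k)                          ≡⟨ ^-*-assoc q (suc k) (suc k) ⟨
    (q ^ suc k) ^ suc k                          ∎
    where
    rearr : ∀ k → suc (suc (suc k) * k) ≡ suc k * suc k
    rearr = solve-∀
    2*suc-q≤ : 2 * suc q ≤ 4 * q
    2*suc-q≤ = begin
      2 * suc q         ≤⟨ *-monoʳ-≤ 2 (+-monoˡ-≤ q (≤-trans (s≤s z≤n) q₀≤q)) ⟩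
      2 * (q + q)       ≡⟨ cong (λ y → 2 * (q + y)) (+-identityʳ q) ⟨
      2 * (2 * q)       ≡⟨ *-assoc 2 2 q ⟨
      4 * q             ∎
    L≤ : L ≤ B * q ^ suc (suc k)
    L≤ = begin
      L                                          ≤⟨ <⇒≤ L< ⟩
      c * (2 * suc q) ^ suc (suc k)              ≤⟨ *-monoʳ-≤ c (^-monoˡ-≤ (suc (suc k)) 2*suc-q≤) ⟩
      c * (4 * q) ^ suc (suc k)                  ≡⟨ cong (c *_) (^-*ˡ 4 q (suc (suc k))) ⟩
      c * (4 ^ suc (suc k) * q ^ suc (suc k))    ≡⟨ *-assoc c _ _ ⟨
      B * q ^ suc (suc k)                        ∎

  module _ {n} (G : Graph n) where

    BigHomogeneous : ℕ → Set
    BigHomogeneous m = Σ (Subset n) λ S → (IsClique G S ⊎ IsIndependent G S) × m ≤ ⌊log₂ ∣ S ∣ ⌋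

    size-bound : ∀ {m xs} → Unique xs → 2 ^ m ≤ length xs → m ≤ ⌊log₂ ∣ fromList xs ∣ ⌋
    size-bound {m} {xs} uxs big = begin
      m                              ≡⟨ ⌊log₂[2^n]⌋≡n m ⟨
      ⌊log₂ (2 ^ m) ⌋                ≤⟨ ⌊log₂⌋-mono-≤ (≤-trans big (length≤∣fromList∣ uxs)) ⟩
      ⌊log₂ ∣ fromList xs ∣ ⌋        ∎

    clique : ∀ {m xs} → Homogeneous (adj G) true xs → 2 ^ m ≤ length xs → BigHomogeneous m
    clique {xs = xs} (uxs , h) big = fromList xs ,
      inj₁ (λ u v u∈ v∈ → h (∈-fromList⁻ xs u∈) (∈-fromList⁻ xs v∈)) , size-bound uxs big

    independent : ∀ {m xs} → Homogeneous (adj G) false xs → 2 ^ m ≤ length xs → BigHomogeneous m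
    independent {xs = xs} (uxs , h) big = fromList xs , inj₂ indep , size-bound uxs big
      where
      indep : IsIndependent G (fromList xs)
      indep u v u∈ v∈ with u Fin.≟ v
      ... | yes refl = irrefl G u
      ... | no u≢v   = h (∈-fromList⁻ xs u∈) (∈-fromList⁻ xs v∈) u≢v

    homogeneous-of-cotree : ∀ {m τ} → Cotree (adj G) τ → 2 ^ (m + m) ≤ size τ → BigHomogeneous m
    homogeneous-of-cotree {m} {τ} cτ big
      with (xs , hx , _) , (ys , hy , _) , h ← cograph-ramsey (sym G) τ cτ
      with 2 ^ m ≤? length xs | 2 ^ m ≤? length ys
    ... | yes p | _     = clique hx p
    ... | no _  | yes p = independent hy p
    ... | no p  | no p′ = contradiction
      (≤-trans (≤-trans (≤-reflexive (≡-sym (^-distribˡ-+-* 2 m m))) big) h)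
      (<⇒≱ (*-mono-< (≰⇒> p) (≰⇒> p′)))

  large : ∀ n → 2 ^ f q₀ ≤ n → (G : Graph n) → NoShatter (adj G) (suc d) →
          Σ (Subset n) λ S → (IsClique G S ⊎ IsIndependent G S) ×
          (⌊log₂ n ⌋ ^ k ≤ ⌊log₂ ∣ S ∣ ⌋ ^ suc k)
  large n N≤n G nosh =
    let S , hom , m≤ = homogeneous-of-cotree G {m} {τ} cτ (≤-reflexive (≡-sym size-τ))
    in S , hom , ≤-trans (exponent q₀≤q L<) (^-monoˡ-≤ (suc k) m≤)
    where
    L = ⌊log₂ n ⌋
    bracketed : ∃ λ q → q₀ ≤ q × f q ≤ L × L < f (suc q)
    bracketed = bracket f
      (≤-trans (≤-reflexive (≡-sym (⌊log₂[2^n]⌋≡n (f q₀)))) (⌊log₂⌋-mono-≤ N≤n))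
      (suc L) (≤-trans (s≤s (m≤m+n L q₀)) (q≤f (suc L + q₀)))
    q = proj₁ bracketed
    q₀≤q = proj₁ (proj₂ bracketed)
    fq≤L = proj₁ (proj₂ (proj₂ bracketed))
    L< = proj₂ (proj₂ (proj₂ bracketed))
    m = q ^ suc k
    2m≤ : m + m ≤ (2 * q) ^ suc k
    2m≤ = begin
      m + m              ≡⟨ cong (m +_) (+-identityʳ m) ⟨
      2 * m              ≤⟨ *-monoˡ-≤ m (m≤m*n 2 (2 ^ k) {{m^n≢0 2 k}}) ⟩
      2 ^ suc k * m      ≡⟨ ^-*ˡ 2 q (suc k) ⟨
      (2 * q) ^ suc k    ∎
    found : CotreeIn (adj G) (2 ^ (m + m)) (allFin n)
    found = log-mono {s = (2 * q) ^ suc k} 2m≤ fq≤L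
      (cographs (≤-trans (≤-trans (≤-trans (m≤m+n r₀ (B ^ k)) (n≤1+n _)) q₀≤q) (m≤n*m q 2)))
      (adj G) (sym G) nosh (allFin n) (Unique.allFin⁺ n)
      (≤-trans (2^⌊log₂⌋≤ n (≤-trans (0<2^ (f q₀)) N≤n)) (≤-reflexive (≡-sym (length-tabulate {n = n} (λ i → i)))))
    τ = proj₁ found
    size-τ = proj₁ (proj₂ found)
    cτ = proj₁ (proj₂ (proj₂ found))
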